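{- Let $G=(V,E)$ be a directed acyclic graph and $s,t\in V$. Let $S$ be a minimum-cardinality identifying set for $X^{\mathrm{path}}_{G,s,t}$ and let $S'$ be a minimum-cardinality identifying set for $X^{\mathrm{flow}}_{G,s,t}$. Then $|S'| \le \frac{(|S|+1)|S|}{2}$. Moreover, for every $k\in\mathbb{N}$ there is such an instance (a directed acyclic graph with nodes $s,t$) in which $|S|=k$ and $|S'| = \frac{(|S|+1)|S|}{2}$.
   Context: $X^{\mathrm{path}}_{G,s,t} := \{\chi_P : P \text{ is an } s\text{ - }t\text{ -path in } G\}\subseteq\{0,1\}^E$, with $\chi_P$ the incidence vector of the arc set of $P$. $X^{\mathrm{flow}}_{G,s,t}$ is the set of all $s$-$t$-flows of value $1$ in $G$, i.e., all $x\in\mathbb{R}_+^E$ satisfying flow conservation at all nodes other than $s,t$, with net outflow $1$ at $s$ and net inflow $1$ at $t$. A set $S \subseteq E$ is identifying for $X$ if for all $x, x' \in X$ with $x \neq x'$ there is $e \in S$ with $x_e \neq x'_e$.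
   Formalization: The set of s-t-flows of value 1 is taken with rational instead of real entries, so a set is identifying for flows when it distinguishes all pairs of distinct rational flows. -}

module Defs where

open import Data.Nat using (ℕ; zero; suc)
open import Data.Fin using (Fin; zero; suc)
import Data.Fin as Fin
open import Data.Fin.Subset using (Subset; _∈_; ∣_∣)
open import Data.List using (List; []; _∷_; map)
open import Data.List.Relation.Unary.Any using (any?)
open import Data.List.Relation.Unary.Unique.Propositional using (Unique)
open import Data.Rational using (ℚ; 0ℚ; 1ℚ; _+_; _≤_)
open import Data.Product using (Σ; _×_; ∃)
open import Data.Bool using (if_then_else_)
open import Relation.Nullary using (¬_; does)
open import Relation.Binary.PropositionalEquality using (_≡_; _≢_)

record Digraph : Set where
  field
    n : ℕ
    m : ℕ
    tail : Fin m → Fin n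
    head : Fin m → Fin n
open Digraph public

-- G=(V,E) with E ⊆ V×V: no two distinct arcs with the same endpoints.
Simple : Digraph → Set
Simple G = ∀ e e' → tail G e ≡ tail G e' → head G e ≡ head G e' → e ≡ e'

data Walk (G : Digraph) : Fin (n G) → Fin (n G) → List (Fin (m G)) → Set where
  nil  : ∀ {u} → Walk G u u []
  cons : ∀ {u v es} (e : Fin (m G)) → tail G e ≡ u → Walk G (head G e) v es → Walk G u v (e ∷ es)

Acyclic : Digraph → Set
Acyclic G = ¬ (Σ (Fin (n G)) λ u → Σ (Fin (m G)) λ e → Σ (List (Fin (m G))) λ es → Walk G u u (e ∷ es))

nodesOf : (G : Digraph) → Fin (n G) → List (Fin (m G)) → List (Fin (n G))
nodesOf G u es = u ∷ map (head G) es

IsPath : (G : Digraph) → Fin (n G) → Fin (n G) → List (Fin (m G)) → Set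
IsPath G s t es = Walk G s t es × Unique (nodesOf G s es)

Vect : Digraph → Set
Vect G = Fin (m G) → ℚ

χ : (G : Digraph) → List (Fin (m G)) → Vect G
χ G es e = if does (any? (Fin._≟_ e) es) then 1ℚ else 0ℚ

Xpath : (G : Digraph) → Fin (n G) → Fin (n G) → Vect G → Set
Xpath G s t x = ∃ λ es → IsPath G s t es × (∀ e → x e ≡ χ G es e)

∑ : ∀ {k} → (Fin k → ℚ) → ℚ
∑ {zero} f = 0ℚ
∑ {suc k} f = f zero + ∑ (λ i → f (suc i))

outflow inflow : (G : Digraph) → Vect G → Fin (n G) → ℚ
outflow G x v = ∑ λ e → if does (tail G e Fin.≟ v) then x e else 0ℚ
inflow  G x v = ∑ λ e → if does (head G e Fin.≟ v) then x e else 0ℚ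

Xflow : (G : Digraph) → Fin (n G) → Fin (n G) → Vect G → Set
Xflow G s t x =
  (∀ e → 0ℚ ≤ x e)
  × (∀ v → v ≢ s → v ≢ t → outflow G x v ≡ inflow G x v)
  × (outflow G x s ≡ inflow G x s + 1ℚ)
  × (inflow G x t ≡ outflow G x t + 1ℚ)

Identifying : (G : Digraph) → (Vect G → Set) → Subset (m G) → Set
Identifying G X S = ∀ x x' → X x → X x' → ¬ (∀ e → x e ≡ x' e) →
  Σ (Fin (m G)) λ e → e ∈ S × x e ≢ x' e

MinIdentifying : (G : Digraph) → (Vect G → Set) → Subset (m G) → Set
MinIdentifying G X S = Identifying G X S × (∀ T → Identifying G X T → ∣ S ∣ Data.Nat.≤ ∣ T ∣)

{-# OPTIONS --safe #-}

-- Upper bound.  Let S identify the s-t-paths.  Two S-avoiding walks between the same nodes of the relevant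
-- part of the graph coincide.  For any vectors Q_v, a circulation z satisfies
-- z = Σ_e z_e (χ_e + Q_head(e) − Q_tail(e)), since the Q-terms cancel at every node.  Let Q_v be the arc vector
-- of a walk from v to t that avoids S if possible and otherwise follows an S-avoiding walk to the tail of some
-- j ∈ S, then j, then the walk chosen for the head of j.  For every relevant arc e, the bracket is then a difference
-- of vectors c(u,j) = χ(u ⇝ tail j) + χ_j + Q_head(j) − Q_u, where j ∈ S, the node u is s or the head of an arc
-- of S, and u ⇝ tail j avoids S.  By acyclicity only one of the pairs (head i, j) and (head j, i) occurs, so
-- there are at most k + k(k−1)/2 generators for k = |S|, and as many coordinates suffice to recognise the zero
-- vector in their span.
--
-- Tightness.  Take a₀, b₀, …, a_k, b_k with arcs a_i → b_j (i ≤ j) and b_i → a_{i+1}.  The arcs b_i → a_{i+1}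
-- identify the paths.  With a strictly positive flow at hand, an identifying set for flows has at least
-- m − n + 1 = k(k+1)/2 elements, and by the upper bound the k arcs are then optimal for paths.
module Submission where

module IdentifyingSets where

  open import Defs
  open import Algebra.Bundles using (CommutativeRing)
  import Algebra.Properties.CommutativeMonoid.Sum as CommutativeMonoidSum
  import Algebra.Properties.Semiring.Sum as SemiringSums
  open import Data.Bool using (Bool; true; false; not; if_then_else_)
  import Data.Bool.Properties as Bool
  open import Data.Fin using (Fin; zero; suc; _≟_; toℕ; punchIn; splitAt; _↑ˡ_; _↑ʳ_)
  open import Data.Fin.Induction using (spo-wellFounded; spo-noetherian)
  open import Data.Fin.Properties using (any?; sequence; punchInᵢ≢i; suc-injective; toℕ-injective)
  open import Data.Fin.Properties using (splitAt-↑ˡ; splitAt-↑ʳ; splitAt⁻¹-↑ˡ; splitAt⁻¹-↑ʳ)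
  open import Data.Fin.Subset using (Subset; _∈_; _∉_; ∣_∣; ∁; ⁅_⁆; ⊥; inside; outside)
  open import Data.Fin.Subset.Properties using (_∈?_; x∉p⇒x∈∁p; x≢y⇒x∉⁅y⁆; ∣⊥∣≡0; ∣p∣≤n; ∣⁅x⁆∣≡1; ∣∁p∣≡n∸∣p∣)
  open import Data.List using (List; []; _∷_; map; _++_; length)
  import Data.List.Membership.Propositional as List
  open import Data.List.Membership.Propositional.Properties using (∈-map⁺; ∈-++⁺ˡ; ∈-++⁺ʳ)
  open import Data.List.Properties using (length-map; length-++)
  open import Data.List.Relation.Unary.All using (All; []; _∷_)
  import Data.List.Relation.Unary.All as All
  import Data.List.Relation.Unary.All.Properties as All
  open import Data.List.Relation.Unary.AllPairs using ([]; _∷_)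
  open import Data.List.Relation.Unary.Any as Any using (here; there)
  open import Data.List.Relation.Unary.Unique.Propositional using (Unique)
  open import Data.Maybe using (Maybe; just; nothing)
  open import Data.Nat as ℕ using (ℕ; zero; suc; s≤s; z≤n)
  import Data.Nat.Properties as ℕ
  import Data.Nat.Solver as ℕSolver
  open import Data.Product using (Σ; _×_; _,_; ∃; proj₁; proj₂)
  open import Data.Rational using (ℚ; 0ℚ; 1ℚ; ½; _+_; _*_; _-_; -_; 1/_; _≤_; _<_; ≢-nonZero; positive; nonNegative)
  import Data.Rational.Properties as ℚₚ
  open ℚₚ using (+-assoc; +-identityˡ; +-identityʳ; +-inverseʳ)
  open ℚₚ using (*-comm; *-identityˡ; *-identityʳ; *-zeroˡ; *-zeroʳ; *-inverseˡ)
  open import Data.Rational.Solver using (module +-*-Solver)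
  open import Data.Sum using (_⊎_; inj₁; inj₂; [_,_]′)
  open import Data.Unit using (⊤; tt)
  open import Data.Vec as Vec using ([]; _∷_; here; there; lookup; _[_]≔_)
  open import Data.Vec.Properties using (lookup-++ˡ; lookup-++ʳ; lookup-replicate; lookup-map; lookup⇒[]=; lookup∘updateAt)
  import Data.Vec.Functional as F
  import Data.Vec.Functional.Properties as F
  open import Effect.Monad using (RawMonad)
  open import Function using (flip; _∘_)
  open import Induction.WellFounded using (Acc; acc; WellFounded)
  open import Relation.Binary using (IsStrictPartialOrder; tri<; tri≈; tri>)
  open import Relation.Binary.PropositionalEquality
  open import Relation.Nullary using (¬_; Dec; does; yes; no; contradiction; ¬?)
  open import Relation.Nullary.Decidable using (dec-true; dec-false; decidable-stable; ¬¬-excluded-middle; _×-dec_)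
  open import Relation.Nullary.Negation using (¬¬-Monad)

  module Sum = CommutativeMonoidSum ℚₚ.+-0-commutativeMonoid
  open Sum using (sum)
  module SemiringSum = SemiringSums (CommutativeRing.semiring ℚₚ.+-*-commutativeRing)
  open +-*-Solver using (solve; _:=_; _:+_; _:*_; _:-_; :-_; con)
  open ℕSolver.+-*-Solver using () renaming (solve to solveℕ; _:+_ to _⊕_; _:*_ to _⊛_; _:=_ to _≔_; con to lit)
  open ≡-Reasoning

  -- Finite sums and linear algebra over ℚ

  ∑≡sum : ∀ {k} (f : Fin k → ℚ) → ∑ f ≡ sum f
  ∑≡sum {zero} f = refl
  ∑≡sum {suc k} f = cong (f zero +_) (∑≡sum (λ i → f (suc i)))

  ∑-cong : ∀ {k} {f g : Fin k → ℚ} → (∀ i → f i ≡ g i) → ∑ f ≡ ∑ g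
  ∑-cong {zero} eq = refl
  ∑-cong {suc k} eq = cong₂ _+_ (eq zero) (∑-cong (λ i → eq (suc i)))

  ∑-+ : ∀ {k} (f g : Fin k → ℚ) → ∑ (λ i → f i + g i) ≡ ∑ f + ∑ g
  ∑-+ f g = trans (∑≡sum (λ i → f i + g i)) (trans (Sum.∑-distrib-+ f g) (sym (cong₂ _+_ (∑≡sum f) (∑≡sum g))))

  ∑-*ˡ : ∀ {k} c (f : Fin k → ℚ) → ∑ (λ i → c * f i) ≡ c * ∑ f
  ∑-*ˡ c f = trans (∑≡sum (λ i → c * f i)) (sym (trans (cong (c *_) (∑≡sum f)) (SemiringSum.*-distribˡ-sum c f)))

  ∑-swap : ∀ {k l} (f : Fin k → Fin l → ℚ) → ∑ (λ i → ∑ (f i)) ≡ ∑ (λ j → ∑ (λ i → f i j))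
  ∑-swap {k} {l} f = begin
    ∑ (λ i → ∑ (f i))            ≡⟨ ∑-cong (λ i → ∑≡sum (f i)) ⟩
    ∑ (λ i → sum (f i))          ≡⟨ ∑≡sum (λ i → sum (f i)) ⟩
    sum (λ i → sum (f i))        ≡⟨ Sum.∑-comm f ⟩
    sum (λ j → sum (λ i → f i j)) ≡⟨ ∑≡sum (λ j → sum (λ i → f i j)) ⟨
    ∑ (λ j → sum (λ i → f i j))  ≡⟨ ∑-cong (λ j → sym (∑≡sum (λ i → f i j))) ⟩
    ∑ (λ j → ∑ (λ i → f i j))    ∎

  ∑-remove : ∀ {k} (i : Fin (suc k)) f → ∑ f ≡ f i + ∑ (λ r → f (punchIn i r))
  ∑-remove i f = trans (∑≡sum f) (trans (Sum.sum-remove {i = i} f) (cong (f i +_) (sym (∑≡sum (λ r → f (punchIn i r))))))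

  ∑-zero : ∀ {k} {f : Fin k → ℚ} → (∀ i → f i ≡ 0ℚ) → ∑ f ≡ 0ℚ
  ∑-zero {zero} eq = refl
  ∑-zero {suc k} eq = trans (cong₂ _+_ (eq zero) (∑-zero (λ i → eq (suc i)))) (+-identityˡ 0ℚ)

  ∑-sub : ∀ {k} (f g : Fin k → ℚ) → ∑ (λ i → f i - g i) ≡ ∑ f - ∑ g
  ∑-sub f g = begin
    ∑ (λ i → f i - g i)
      ≡⟨ ∑-cong (λ i → solve 2 (λ a b → a :- b := a :+ con (- 1ℚ) :* b) refl (f i) (g i)) ⟩
    ∑ (λ i → f i + - 1ℚ * g i)     ≡⟨ ∑-+ f _ ⟩
    ∑ f + ∑ (λ i → - 1ℚ * g i)     ≡⟨ cong (∑ f +_) (∑-*ˡ (- 1ℚ) g) ⟩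
    ∑ f + - 1ℚ * ∑ g               ≡⟨ solve 2 (λ a b → a :+ con (- 1ℚ) :* b := a :- b) refl (∑ f) (∑ g) ⟩
    ∑ f - ∑ g ∎

  δ : ∀ {k} → Fin k → Fin k → ℚ
  δ i j = if does (i ≟ j) then 1ℚ else 0ℚ

  δ-refl : ∀ {k} (i : Fin k) → δ i i ≡ 1ℚ
  δ-refl i rewrite dec-true (i ≟ i) refl = refl

  δ-≢ : ∀ {k} {i j : Fin k} → i ≢ j → δ i j ≡ 0ℚ
  δ-≢ {i = i} {j} i≢j rewrite dec-false (i ≟ j) i≢j = refl

  ∑-δ : ∀ {k} (i : Fin k) (f : Fin k → ℚ) → ∑ (λ j → δ i j * f j) ≡ f i
  ∑-δ {suc k} i f = begin
    ∑ (λ j → δ i j * f j)  ≡⟨ ∑-remove i (λ j → δ i j * f j) ⟩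
    δ i i * f i + ∑ (λ r → δ i (punchIn i r) * f (punchIn i r))
      ≡⟨ cong₂ (λ a b → a * f i + b) (δ-refl i)
           (∑-zero λ r → trans (cong (_* f (punchIn i r)) (δ-≢ (λ eq → punchInᵢ≢i i r (sym eq)))) (*-zeroˡ (f (punchIn i r)))) ⟩
    1ℚ * f i + 0ℚ          ≡⟨ trans (+-identityʳ _) (*-identityˡ _) ⟩
    f i ∎

  x-y≡0⇒x≡y : ∀ {x y} → x - y ≡ 0ℚ → x ≡ y
  x-y≡0⇒x≡y {x} {y} eq = begin
    x            ≡⟨ solve 2 (λ a b → a := (a :- b) :+ b) refl x y ⟩
    (x - y) + y  ≡⟨ cong (_+ y) eq ⟩
    0ℚ + y       ≡⟨ +-identityˡ y ⟩
    y ∎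

  x≡y⇒x-y≡0 : ∀ {x y} → x ≡ y → x - y ≡ 0ℚ
  x≡y⇒x-y≡0 {x} refl = +-inverseʳ x

  -- Gaussian elimination on fewer equations than unknowns. A zero equation is dropped; otherwise a
  -- pivot eliminates one unknown and one equation, and back-substitution extends the smaller
  -- solution.
  homogeneous-solution : ∀ {N} (fs : List (Fin N → ℚ)) → length fs ℕ.< N →
    ∃ λ (c : Fin N → ℚ) → (∃ λ i → c i ≢ 0ℚ) × All (λ f → ∑ (λ i → c i * f i) ≡ 0ℚ) fs
  homogeneous-solution fs = go (length fs) fs refl
    where
    go : ∀ {N} l (fs : List (Fin N → ℚ)) → length fs ≡ l → l ℕ.< N →
      ∃ λ (c : Fin N → ℚ) → (∃ λ i → c i ≢ 0ℚ) × All (λ f → ∑ (λ i → c i * f i) ≡ 0ℚ) fs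
    go {suc N} zero [] _ _ = (λ _ → 1ℚ) , (zero , λ ()) , []
    go {suc N} (suc l) (f ∷ fs) eq (s≤s l<N) with any? (λ i → ¬? (f i ℚₚ.≟ 0ℚ))
    ... | no f≡0 =
      let c , nz , sol = go l fs (ℕ.suc-injective eq) (ℕ.m<n⇒m<1+n l<N) in
      c , nz ,
      ∑-zero (λ i → trans (cong (c i *_) (decidable-stable (f i ℚₚ.≟ 0ℚ) (λ fi≢0 → f≡0 (i , fi≢0)))) (*-zeroʳ (c i)))
        ∷ sol
    ... | yes (i , fi≢0) =
      c , (punchIn i j , c-nz) , eliminated f pivot-vanishes ∷ All.map (λ {g} → eliminated g) (All.map⁻ sol)
      where
      instance _ = ≢-nonZero fi≢0
      p⁻¹ = 1/ f i
      reduce : (Fin (suc N) → ℚ) → Fin N → ℚ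
      reduce g r = g (punchIn i r) - f (punchIn i r) * p⁻¹ * g i
      rec = go l (map reduce fs) (trans (length-map reduce fs) (ℕ.suc-injective eq)) l<N
      c′ = proj₁ rec
      j = proj₁ (proj₁ (proj₂ rec))
      sol = proj₂ (proj₂ rec)
      -- The value that the pivot equation `f` forces on the eliminated unknown.
      cᵢ = - (∑ (λ r → c′ r * f (punchIn i r))) * p⁻¹
      c = F.insertAt c′ i cᵢ
      c-nz : c (punchIn i j) ≢ 0ℚ
      c-nz eq = proj₂ (proj₁ (proj₂ rec)) (trans (sym (F.insertAt-punchIn c′ i cᵢ j)) eq)
      eliminated : ∀ g → ∑ (λ r → c′ r * reduce g r) ≡ 0ℚ → ∑ (λ i → c i * g i) ≡ 0ℚ
      eliminated g eq = begin
        ∑ (λ i → c i * g i)  ≡⟨ ∑-remove i (λ i → c i * g i) ⟩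
        c i * g i + ∑ (λ r → c (punchIn i r) * g (punchIn i r))
          ≡⟨ cong₂ (λ a b → a * g i + b) (F.insertAt-lookup c′ i cᵢ)
               (∑-cong (λ r → cong (_* g (punchIn i r)) (F.insertAt-punchIn c′ i cᵢ r))) ⟩
        - F * p⁻¹ * g i + ∑ (λ r → c′ r * g (punchIn i r))
          ≡⟨ solve 4 (λ F p g s → :- F :* p :* g :+ s := s :- (p :* g) :* F) refl F p⁻¹ (g i) _ ⟩
        ∑ (λ r → c′ r * g (punchIn i r)) - (p⁻¹ * g i) * F
          ≡⟨ cong (λ a → ∑ (λ r → c′ r * g (punchIn i r)) - a) (sym (∑-*ˡ (p⁻¹ * g i) (λ r → c′ r * f (punchIn i r)))) ⟩
        ∑ (λ r → c′ r * g (punchIn i r)) - ∑ (λ r → (p⁻¹ * g i) * (c′ r * f (punchIn i r)))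
          ≡⟨ ∑-sub (λ r → c′ r * g (punchIn i r)) (λ r → (p⁻¹ * g i) * (c′ r * f (punchIn i r))) ⟨
        ∑ (λ r → c′ r * g (punchIn i r) - (p⁻¹ * g i) * (c′ r * f (punchIn i r)))
          ≡⟨ ∑-cong (λ r → solve 5 (λ c g f p gi → c :* g :- (p :* gi) :* (c :* f) := c :* (g :- f :* p :* gi)) refl
                             (c′ r) (g (punchIn i r)) (f (punchIn i r)) p⁻¹ (g i)) ⟩
        ∑ (λ r → c′ r * reduce g r) ≡⟨ eq ⟩
        0ℚ ∎
        where F = ∑ (λ r → c′ r * f (punchIn i r))
      -- `reduce` sends the pivot equation itself to zero, so `eliminated` covers `f` and the other
      -- equations alike.
      pivot-vanishes : ∑ (λ r → c′ r * reduce f r) ≡ 0ℚ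
      pivot-vanishes = ∑-zero λ r → begin
        c′ r * (f (punchIn i r) - f (punchIn i r) * p⁻¹ * f i)
          ≡⟨ solve 4 (λ c f p fi → c :* (f :- f :* p :* fi) := c :* (f :- f :* (p :* fi))) refl (c′ r) (f (punchIn i r)) p⁻¹ (f i) ⟩
        c′ r * (f (punchIn i r) - f (punchIn i r) * (p⁻¹ * f i))
          ≡⟨ cong (λ a → c′ r * (f (punchIn i r) - f (punchIn i r) * a)) (*-inverseˡ (f i)) ⟩
        c′ r * (f (punchIn i r) - f (punchIn i r) * 1ℚ)
          ≡⟨ solve 2 (λ c f → c :* (f :- f :* con 1ℚ) := con 0ℚ) refl (c′ r) (f (punchIn i r)) ⟩
        0ℚ ∎

  -- Spans of rational vectors and coordinates that detect zero

  Span : ∀ {k} → List (Fin k → ℚ) → (Fin k → ℚ) → Set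
  Span [] z = ∀ i → z i ≡ 0ℚ
  Span (g ∷ gs) z = Σ ℚ λ y → Span gs (λ i → z i - y * g i)

  Span-resp : ∀ {k} (gs : List (Fin k → ℚ)) {z w} → (∀ i → z i ≡ w i) → Span gs z → Span gs w
  Span-resp [] eq z≡0 i = trans (sym (eq i)) (z≡0 i)
  Span-resp (g ∷ gs) eq (y , s) = y , Span-resp gs (λ i → cong (_- y * g i) (eq i)) s

  Span-combine : ∀ {k} (gs : List (Fin k → ℚ)) {z w} a → Span gs z → Span gs w → Span gs (λ i → a * z i + w i)
  Span-combine [] a z≡0 w≡0 i =
    trans (cong₂ (λ p q → a * p + q) (z≡0 i) (w≡0 i)) (solve 1 (λ a → a :* con 0ℚ :+ con 0ℚ := con 0ℚ) refl a)
  Span-combine (g ∷ gs) {z} {w} a (y , sz) (y′ , sw) = a * y + y′ ,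
    Span-resp gs (λ i → solve 6 (λ a z y g w y′ → a :* (z :- y :* g) :+ (w :- y′ :* g) := (a :* z :+ w) :- (a :* y :+ y′) :* g)
                          refl a (z i) y (g i) (w i) y′)
      (Span-combine gs a sz sw)

  Span-zero : ∀ {k} (gs : List (Fin k → ℚ)) {z} → (∀ i → z i ≡ 0ℚ) → Span gs z
  Span-zero [] z≡0 = z≡0
  Span-zero (g ∷ gs) z≡0 = 0ℚ , Span-zero gs λ i →
    trans (cong (_- 0ℚ * g i) (z≡0 i)) (solve 1 (λ g → con 0ℚ :- con 0ℚ :* g := con 0ℚ) refl (g i))

  Span-∈ : ∀ {k} {gs : List (Fin k → ℚ)} {g} → g List.∈ gs → Span gs g
  Span-∈ {gs = g ∷ gs} (here refl) = 1ℚ , Span-zero gs (λ i → solve 1 (λ g → g :- con 1ℚ :* g := con 0ℚ) refl (g i))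
  Span-∈ {gs = h ∷ gs} {g} (there g∈gs) =
    0ℚ , Span-resp gs (λ i → solve 2 (λ g h → g := g :- con 0ℚ :* h) refl (g i) (h i)) (Span-∈ g∈gs)

  Span-sub : ∀ {k} (gs : List (Fin k → ℚ)) {z w} → Span gs z → Span gs w → Span gs (λ i → z i - w i)
  Span-sub gs {z} {w} sz sw =
    Span-resp gs (λ i → solve 2 (λ z w → con (- 1ℚ) :* w :+ z := z :- w) refl (z i) (w i))
      (Span-combine gs (- 1ℚ) sw sz)

  -- Membership is asked only of terms with a non-zero coefficient. Arcs that lie on no walk from s
  -- to t carry the coefficient zero in a flow difference, and nothing is known about their vectors.
  Span-∑ : ∀ {k l} (gs : List (Fin k → ℚ)) (a : Fin l → ℚ) (z : Fin l → Fin k → ℚ) →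
    (∀ e → a e ≢ 0ℚ → Span gs (z e)) → Span gs (λ i → ∑ λ e → a e * z e i)
  Span-∑ {l = zero} gs a z s = Span-zero gs (λ _ → refl)
  Span-∑ {l = suc l} gs a z s with Span-∑ gs (λ e → a (suc e)) (λ e → z (suc e)) (λ e → s (suc e)) | a zero ℚₚ.≟ 0ℚ
  ... | rec | yes a≡0 = Span-resp gs (λ i → sym (trans (cong (λ b → b * z zero i + rest i) a≡0)
                          (solve 2 (λ b r → con 0ℚ :* b :+ r := r) refl (z zero i) (rest i)))) rec
    where rest = λ i → ∑ λ e → a (suc e) * z (suc e) i
  ... | rec | no a≢0 = Span-combine gs (a zero) (s zero a≢0) rec

  Linear : ∀ {k} → ((Fin k → ℚ) → Fin k → ℚ) → Set
  Linear π = ∀ z w y i → π (λ j → z j - y * w j) i ≡ π z i - y * π w i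

  Span-map : ∀ {k} {π : (Fin k → ℚ) → Fin k → ℚ} → Linear π → (∀ {z} → (∀ i → z i ≡ 0ℚ) → ∀ i → π z i ≡ 0ℚ) →
    ∀ gs {z} → Span gs z → Span (map π gs) (π z)
  Span-map lin π0 [] z≡0 = π0 z≡0
  Span-map lin π0 (g ∷ gs) {z} (y , s) = y , Span-resp (map _ gs) (lin z g y) (Span-map lin π0 gs s)

  ∣p[x]≔inside∣≤1+∣p∣ : ∀ {k} (p : Subset k) x → ∣ p [ x ]≔ inside ∣ ℕ.≤ suc ∣ p ∣
  ∣p[x]≔inside∣≤1+∣p∣ (outside ∷ p) zero = ℕ.≤-refl
  ∣p[x]≔inside∣≤1+∣p∣ (inside ∷ p) zero = ℕ.n≤1+n _
  ∣p[x]≔inside∣≤1+∣p∣ (outside ∷ p) (suc x) = ∣p[x]≔inside∣≤1+∣p∣ p x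
  ∣p[x]≔inside∣≤1+∣p∣ (inside ∷ p) (suc x) = s≤s (∣p[x]≔inside∣≤1+∣p∣ p x)

  ∈-insert : ∀ {k} (p : Subset k) {y} x → y ∈ p → y ∈ p [ x ]≔ inside
  ∈-insert (_ ∷ p) zero here = here
  ∈-insert (_ ∷ p) zero (there q) = there q
  ∈-insert (_ ∷ p) (suc x) here = here
  ∈-insert (_ ∷ p) (suc x) (there q) = there (∈-insert p x q)

  -- Row reduction: every non-zero generator contributes one pivot coordinate, which is then cleared
  -- from the remaining generators. Hence at most one coordinate per generator is chosen.
  detecting-coordinates : ∀ {k} (gs : List (Fin k → ℚ)) → Σ (Subset k) λ T →
    ∣ T ∣ ℕ.≤ length gs × (∀ z → Span gs z → (∀ i → i ∈ T → z i ≡ 0ℚ) → ∀ i → z i ≡ 0ℚ)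
  detecting-coordinates gs = go (length gs) gs refl
    where
    go : ∀ {k} l (gs : List (Fin k → ℚ)) → length gs ≡ l → Σ (Subset k) λ T →
      ∣ T ∣ ℕ.≤ l × (∀ z → Span gs z → (∀ i → i ∈ T → z i ≡ 0ℚ) → ∀ i → z i ≡ 0ℚ)
    go {k} zero [] _ = ⊥ , ℕ.≤-reflexive (∣⊥∣≡0 k) , λ _ s _ → s
    go (suc l) (g ∷ gs) eq with any? (λ i → ¬? (g i ℚₚ.≟ 0ℚ))
    ... | no g≡0 =
      let T , T≤ , detects = go l gs (ℕ.suc-injective eq) in
      T , ℕ.m≤n⇒m≤1+n T≤ , λ z (y , s) → detects z (Span-resp gs (λ i → begin
        z i - y * g i  ≡⟨ cong (λ a → z i - y * a) (decidable-stable (g i ℚₚ.≟ 0ℚ) (λ gi≢0 → g≡0 (i , gi≢0))) ⟩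
        z i - y * 0ℚ   ≡⟨ solve 2 (λ z y → z :- y :* con 0ℚ := z) refl (z i) y ⟩
        z i ∎) s)
    ... | yes (e , ge≢0) = T [ e ]≔ inside , ℕ.≤-trans (∣p[x]≔inside∣≤1+∣p∣ T e) (s≤s T≤) , detects′
      where
      instance _ = ≢-nonZero ge≢0
      p⁻¹ = 1/ g e
      π : (Fin _ → ℚ) → Fin _ → ℚ
      π z i = z i - z e * p⁻¹ * g i
      rec = go l (map π gs) (trans (length-map π gs) (ℕ.suc-injective eq))
      T = proj₁ rec
      T≤ = proj₁ (proj₂ rec)
      π-lin : Linear π
      π-lin z w y i = solve 7 (λ zi y wi ze we p gi →
        (zi :- y :* wi) :- (ze :- y :* we) :* p :* gi := (zi :- ze :* p :* gi) :- y :* (wi :- we :* p :* gi))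
        refl (z i) y (w i) (z e) (w e) p⁻¹ (g i)
      π-zero : ∀ {z} → (∀ i → z i ≡ 0ℚ) → ∀ i → π z i ≡ 0ℚ
      π-zero z≡0 i = trans (cong₂ (λ a b → a - b * p⁻¹ * g i) (z≡0 i) (z≡0 e))
        (solve 2 (λ p g → con 0ℚ :- con 0ℚ :* p :* g := con 0ℚ) refl p⁻¹ (g i))
      detects′ : ∀ z → Span (g ∷ gs) z → (∀ i → i ∈ T [ e ]≔ inside → z i ≡ 0ℚ) → ∀ i → z i ≡ 0ℚ
      -- `π` kills `g` and fixes every vector that vanishes at `e`, so it sends `z - y * g` to `z`.
      -- Thus `z` lies in the span of the reduced generators.
      detects′ z (y , s) zT = proj₂ (proj₂ rec) z (Span-resp (map π gs) πz≡z (Span-map π-lin π-zero gs s))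
        (λ i i∈T → zT i (∈-insert T e i∈T))
        where
        ze≡0 = zT e (lookup⇒[]= e _ (lookup∘updateAt e T))
        πz≡z : ∀ i → π (λ j → z j - y * g j) i ≡ z i
        πz≡z i = begin
          (z i - y * g i) - (z e - y * g e) * p⁻¹ * g i
            ≡⟨ solve 6 (λ zi y gi ze ge p → (zi :- y :* gi) :- (ze :- y :* ge) :* p :* gi
                         := zi :- ze :* p :* gi :- y :* gi :+ y :* gi :* (p :* ge)) refl (z i) y (g i) (z e) (g e) p⁻¹ ⟩
          z i - z e * p⁻¹ * g i - y * g i + y * g i * (p⁻¹ * g e)
            ≡⟨ cong₂ (λ a b → z i - a * p⁻¹ * g i - y * g i + y * g i * b) ze≡0 (*-inverseˡ (g e)) ⟩
          z i - 0ℚ * p⁻¹ * g i - y * g i + y * g i * 1ℚ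
            ≡⟨ solve 4 (λ z p g y → z :- con 0ℚ :* p :* g :- y :* g :+ y :* g :* con 1ℚ := z) refl (z i) p⁻¹ (g i) y ⟩
          z i ∎

  -- Sums of arc vectors at the nodes

  δ-comm : ∀ {k} (i j : Fin k) → δ i j ≡ δ j i
  δ-comm i j with i ≟ j
  ... | yes refl = sym (δ-refl i)
  ... | no i≢j = sym (δ-≢ (i≢j ∘ sym))

  -- The common form of `outflow` (with `φ` the tail map) and `inflow` (with `φ` the head map), so
  -- that each fact is proved once for both.
  through : ∀ {k l} → (Fin k → Fin l) → (Fin k → ℚ) → Fin l → ℚ
  through φ x v = ∑ λ e → if does (φ e ≟ v) then x e else 0ℚ

  through-δ : ∀ {k l} (φ : Fin k → Fin l) x v → through φ x v ≡ ∑ λ e → δ (φ e) v * x e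
  through-δ φ x v = ∑-cong λ e → scale (does (φ e ≟ v)) (x e)
    where
    scale : ∀ b y → (if b then y else 0ℚ) ≡ (if b then 1ℚ else 0ℚ) * y
    scale true y = sym (*-identityˡ y)
    scale false y = sym (*-zeroˡ y)

  through-linear : ∀ {k l} (φ : Fin k → Fin l) x a y v →
    through φ (λ e → x e + a * y e) v ≡ through φ x v + a * through φ y v
  through-linear φ x a y v = begin
    through φ (λ e → x e + a * y e) v               ≡⟨ through-δ φ _ v ⟩
    ∑ (λ e → δ (φ e) v * (x e + a * y e))
      ≡⟨ ∑-cong (λ e → solve 4 (λ d x a y → d :* (x :+ a :* y) := d :* x :+ a :* (d :* y)) refl (δ (φ e) v) (x e) a (y e)) ⟩
    ∑ (λ e → δ (φ e) v * x e + a * (δ (φ e) v * y e)) ≡⟨ ∑-+ (λ e → δ (φ e) v * x e) (λ e → a * (δ (φ e) v * y e)) ⟩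
    ∑ (λ e → δ (φ e) v * x e) + ∑ (λ e → a * (δ (φ e) v * y e))
      ≡⟨ cong₂ _+_ (sym (through-δ φ x v)) (trans (∑-*ˡ a (λ e → δ (φ e) v * y e)) (cong (a *_) (sym (through-δ φ y v)))) ⟩
    through φ x v + a * through φ y v ∎

  through-cong : ∀ {k l} (φ : Fin k → Fin l) {x y} → (∀ e → x e ≡ y e) → ∀ v → through φ x v ≡ through φ y v
  through-cong φ eq v = ∑-cong λ e → cong (λ a → if does (φ e ≟ v) then a else 0ℚ) (eq e)

  through-sub : ∀ {k l} (φ : Fin k → Fin l) x y v → through φ (λ e → x e - y e) v ≡ through φ x v - through φ y v
  through-sub φ x y v = begin
    through φ (λ e → x e - y e) v         ≡⟨ through-cong φ (λ e → minus (x e) (y e)) v ⟩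
    through φ (λ e → x e + - 1ℚ * y e) v  ≡⟨ through-linear φ x (- 1ℚ) y v ⟩
    through φ x v + - 1ℚ * through φ y v  ≡⟨ minus (through φ x v) (through φ y v) ⟨
    through φ x v - through φ y v ∎
    where
    minus : ∀ a b → a - b ≡ a + - 1ℚ * b
    minus = solve 2 (λ a b → a :- b := a :+ con (- 1ℚ) :* b) refl

  -- Exchanging the two sums moves a function on nodes onto the arcs.
  through-dual : ∀ {k l} (φ : Fin k → Fin l) x q → ∑ (λ v → through φ x v * q v) ≡ ∑ λ e → x e * q (φ e)
  through-dual φ x q = begin
    ∑ (λ v → through φ x v * q v)
      ≡⟨ ∑-cong (λ v → trans (*-comm (through φ x v) (q v)) (cong (q v *_) (through-δ φ x v))) ⟩
    ∑ (λ v → q v * ∑ (λ e → δ (φ e) v * x e))      ≡⟨ ∑-cong (λ v → sym (∑-*ˡ (q v) (λ e → δ (φ e) v * x e))) ⟩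
    ∑ (λ v → ∑ (λ e → q v * (δ (φ e) v * x e)))    ≡⟨ ∑-swap (λ v e → q v * (δ (φ e) v * x e)) ⟩
    ∑ (λ e → ∑ (λ v → q v * (δ (φ e) v * x e)))
      ≡⟨ ∑-cong (λ e → ∑-cong (λ v → solve 3 (λ q d x → q :* (d :* x) := x :* (d :* q)) refl (q v) (δ (φ e) v) (x e))) ⟩
    ∑ (λ e → ∑ (λ v → x e * (δ (φ e) v * q v)))    ≡⟨ ∑-cong (λ e → ∑-*ˡ (x e) (λ v → δ (φ e) v * q v)) ⟩
    ∑ (λ e → x e * ∑ (λ v → δ (φ e) v * q v))      ≡⟨ ∑-cong (λ e → cong (x e *_) (∑-δ (φ e) q)) ⟩
    ∑ (λ e → x e * q (φ e)) ∎

  through-total : ∀ {k l} (φ : Fin k → Fin l) x → ∑ (through φ x) ≡ ∑ x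
  through-total φ x = begin
    ∑ (through φ x)                ≡⟨ ∑-cong (λ v → sym (*-identityʳ (through φ x v))) ⟩
    ∑ (λ v → through φ x v * 1ℚ)   ≡⟨ through-dual φ x (λ _ → 1ℚ) ⟩
    ∑ (λ e → x e * 1ℚ)             ≡⟨ ∑-cong (λ e → *-identityʳ (x e)) ⟩
    ∑ x ∎

  ∑-nonNeg : ∀ {k} {f : Fin k → ℚ} → (∀ i → 0ℚ ≤ f i) → 0ℚ ≤ ∑ f
  ∑-nonNeg {zero} f≥0 = ℚₚ.≤-refl
  ∑-nonNeg {suc k} {f} f≥0 = ℚₚ.+-mono-≤ (f≥0 zero) (∑-nonNeg (λ i → f≥0 (suc i)))

  ∑-nonPos : ∀ {k} {f : Fin k → ℚ} → (∀ i → f i ≤ 0ℚ) → ∑ f ≤ 0ℚ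
  ∑-nonPos {zero} f≤0 = ℚₚ.≤-refl
  ∑-nonPos {suc k} {f} f≤0 = ℚₚ.+-mono-≤ (f≤0 zero) (∑-nonPos (λ i → f≤0 (suc i)))

  ∑-pos : ∀ {k} {f : Fin k → ℚ} → (∀ i → 0ℚ ≤ f i) → ∀ i → 0ℚ < f i → 0ℚ < ∑ f
  ∑-pos {suc k} f≥0 zero fi>0 = ℚₚ.+-mono-<-≤ fi>0 (∑-nonNeg (λ i → f≥0 (suc i)))
  ∑-pos {suc k} f≥0 (suc i) fi>0 = ℚₚ.+-mono-≤-< (f≥0 zero) (∑-pos (λ i → f≥0 (suc i)) i fi>0)

  if-nonNeg : ∀ b {x} → 0ℚ ≤ x → 0ℚ ≤ (if b then x else 0ℚ)
  if-nonNeg true x≥0 = x≥0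
  if-nonNeg false _ = ℚₚ.≤-refl

  through-pos : ∀ {k l} (φ : Fin k → Fin l) {x} → (∀ e → 0ℚ ≤ x e) → ∀ e → 0ℚ < x e → 0ℚ < through φ x (φ e)
  through-pos φ {x} x≥0 e xe>0 = ∑-pos (λ f → if-nonNeg (does (φ f ≟ φ e)) (x≥0 f)) e
    (subst (λ b → 0ℚ < (if b then x e else 0ℚ)) (sym (dec-true (φ e ≟ φ e) refl)) xe>0)

  through-pos⁻¹ : ∀ {k l} (φ : Fin k → Fin l) {x} v → 0ℚ < through φ x v → ∃ λ e → φ e ≡ v × 0ℚ < x e
  through-pos⁻¹ φ {x} v pos with any? (λ e → 0ℚ ℚₚ.<? (if does (φ e ≟ v) then x e else 0ℚ))
  ... | no none = contradiction (ℚₚ.<-≤-trans pos (∑-nonPos λ e → ℚₚ.≮⇒≥ λ lt → none (e , lt))) (ℚₚ.<-irrefl refl)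
  ... | yes (e , lt) with φ e ≟ v
  ...   | yes eq = e , eq , lt
  ...   | no _ = contradiction refl (ℚₚ.<⇒≢ lt)

  -- Circulations, flows and walks

  module Graph (G : Digraph) where

    private
      V = Fin (n G)
      E = Fin (m G)

    Circulation : Vect G → Set
    Circulation z = ∀ v → outflow G z v ≡ inflow G z v

    -- Holds for every family of vectors Q, because the contributions of Q cancel node by node.
    circulation-expansion : ∀ {z} → Circulation z → (Q : V → E → ℚ) → ∀ f →
      z f ≡ ∑ λ e → z e * (δ e f + Q (head G e) f - Q (tail G e) f)
    circulation-expansion {z} circ Q f = sym (begin
      ∑ (λ e → z e * (δ e f + Q (head G e) f - Q (tail G e) f))
        ≡⟨ ∑-cong (λ e → trans (solve 4 (λ z d h t → z :* (d :+ h :- t) := (d :* z :+ z :* h) :- z :* t) refl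
                                 (z e) (δ e f) (Q (head G e) f) (Q (tail G e) f))
                    (cong (λ d → (d * z e + z e * Q (head G e) f) - z e * Q (tail G e) f) (δ-comm e f))) ⟩
      ∑ (λ e → (δ f e * z e + z e * Q (head G e) f) - z e * Q (tail G e) f)
        ≡⟨ ∑-sub (λ e → δ f e * z e + z e * Q (head G e) f) (λ e → z e * Q (tail G e) f) ⟩
      ∑ (λ e → δ f e * z e + z e * Q (head G e) f) - ∑ (λ e → z e * Q (tail G e) f)
        ≡⟨ cong (_- ∑ (λ e → z e * Q (tail G e) f)) (trans (∑-+ (λ e → δ f e * z e) (λ e → z e * Q (head G e) f))
             (cong₂ _+_ (∑-δ f z) (sym (through-dual (head G) z (λ v → Q v f))))) ⟩
      (z f + ∑ (λ v → inflow G z v * Q v f)) - ∑ (λ e → z e * Q (tail G e) f)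
        ≡⟨ cong₂ (λ a b → (z f + a) - b) (∑-cong (λ v → cong (_* Q v f) (sym (circ v)))) (sym (through-dual (tail G) z (λ v → Q v f))) ⟩
      (z f + ∑ (λ v → outflow G z v * Q v f)) - ∑ (λ v → outflow G z v * Q v f)
        ≡⟨ solve 2 (λ z s → (z :+ s) :- s := z) refl (z f) (∑ (λ v → outflow G z v * Q v f)) ⟩
      z f ∎)

    -- The unit terms at s and t are the same for both flows and cancel.
    flow-difference : ∀ {s t x x′} → Xflow G s t x → Xflow G s t x′ → Circulation (λ e → x e - x′ e)
    flow-difference {s} {t} {x} {x′} (_ , cons-x , out-s , in-t) (_ , cons-x′ , out-s′ , in-t′) v = begin
      outflow G (λ e → x e - x′ e) v   ≡⟨ through-sub (tail G) x x′ v ⟩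
      outflow G x v - outflow G x′ v   ≡⟨ balance ⟩
      inflow G x v - inflow G x′ v     ≡⟨ through-sub (head G) x x′ v ⟨
      inflow G (λ e → x e - x′ e) v ∎
      where
      cancel : ∀ a b → (a + 1ℚ) - (b + 1ℚ) ≡ a - b
      cancel = solve 2 (λ a b → (a :+ con 1ℚ) :- (b :+ con 1ℚ) := a :- b) refl
      balance : outflow G x v - outflow G x′ v ≡ inflow G x v - inflow G x′ v
      balance with v ≟ s | v ≟ t
      ... | yes refl | _ = trans (cong₂ _-_ out-s out-s′) (cancel (inflow G x v) (inflow G x′ v))
      ... | no _ | yes refl = sym (trans (cong₂ _-_ in-t in-t′) (cancel (outflow G x v) (outflow G x′ v)))
      ... | no v≢s | no v≢t = cong₂ _-_ (cons-x v v≢s v≢t) (cons-x′ v v≢s v≢t)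

    _++ʷ_ : ∀ {u v w es fs} → Walk G u v es → Walk G v w fs → Walk G u w (es ++ fs)
    nil ++ʷ q = q
    cons e eq p ++ʷ q = cons e eq (p ++ʷ q)

    walk-to-tail : ∀ {u v es f} → Walk G u v es → f List.∈ es → ∃ λ ps → Walk G u (tail G f) ps
    walk-to-tail (cons e refl p) (here refl) = [] , nil
    walk-to-tail (cons e eq p) (there f∈es) with walk-to-tail p f∈es
    ... | ps , q = e ∷ ps , cons e eq q

    Reach : V → V → Set
    Reach u v = ∃ λ es → Walk G u v es

    -- Reachability by a non-empty walk. In an acyclic graph it is a strict partial order on a
    -- finite set, hence well-founded in both directions.
    _⊏_ : V → V → Set
    u ⊏ v = ∃ λ e → ∃ λ es → Walk G u v (e ∷ es)

    ⊏-trans : ∀ {u v w} → u ⊏ v → v ⊏ w → u ⊏ w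
    ⊏-trans (e , es , p) (f , fs , q) = e , es ++ f ∷ fs , p ++ʷ q

    reach-arc⇒⊏ : ∀ {u v} e → Reach u (tail G e) → Reach (head G e) v → u ⊏ v
    reach-arc⇒⊏ e ([] , nil) (qs , q) = e , qs , cons e refl q
    reach-arc⇒⊏ e (f ∷ ps , p) (qs , q) = f , ps ++ e ∷ qs , p ++ʷ cons e refl q

    -- Arc multiplicities. Unlike `χ`, they add up under concatenation of walks; on walks of an
    -- acyclic graph the two agree.
    cnt : List E → E → ℚ
    cnt [] f = 0ℚ
    cnt (e ∷ es) f = δ e f + cnt es f

    cnt-++ : ∀ es fs f → cnt (es ++ fs) f ≡ cnt es f + cnt fs f
    cnt-++ [] fs f = sym (+-identityˡ (cnt fs f))
    cnt-++ (e ∷ es) fs f = trans (cong (δ e f +_) (cnt-++ es fs f)) (sym (+-assoc (δ e f) (cnt es f) (cnt fs f)))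

    cnt-∉ : ∀ {es f} → All (f ≢_) es → cnt es f ≡ 0ℚ
    cnt-∉ [] = refl
    cnt-∉ (f≢e ∷ f∉es) = trans (cong₂ _+_ (δ-≢ (f≢e ∘ sym)) (cnt-∉ f∉es)) (+-identityˡ 0ℚ)

    module Dag (acyclic : Acyclic G) where

      ⊏-irrefl : ∀ {v} → ¬ v ⊏ v
      ⊏-irrefl {v} (e , es , p) = acyclic (v , e , es , p)

      ⊏-isStrictPartialOrder : IsStrictPartialOrder _≡_ _⊏_
      ⊏-isStrictPartialOrder = record
        { isEquivalence = isEquivalence
        ; irrefl = λ { refl → ⊏-irrefl }
        ; trans = ⊏-trans
        ; <-resp-≈ = resp₂ _⊏_
        }

      ⊏-wellFounded : WellFounded _⊏_
      ⊏-wellFounded = spo-wellFounded ⊏-isStrictPartialOrder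

      ⊐-wellFounded : WellFounded (flip _⊏_)
      ⊐-wellFounded = spo-noetherian ⊏-isStrictPartialOrder

      -- A repeated node would close a directed cycle. Every walk from s to t is therefore a path.
      walk-unique : ∀ {u v es} → Walk G u v es → Unique (nodesOf G u es)
      walk-unique nil = [] ∷ []
      walk-unique p@(cons e _ q) = All.map⁺ (All.tabulate λ f∈es u≡head →
        ⊏-irrefl (subst (_ ⊏_) (sym u≡head) (reach-arc⇒⊏ _ (walk-to-tail p f∈es) ([] , nil)))) ∷ walk-unique q

      χ≡cnt : ∀ {u v es} → Walk G u v es → ∀ f → χ G es f ≡ cnt es f
      χ≡cnt nil f = refl
      χ≡cnt {es = e ∷ es} (cons e eq p) f with f ≟ e
      ... | yes refl = sym (trans (cong₂ _+_ (δ-refl e) (cnt-∉ (All.tabulate e∉es))) (+-identityʳ 1ℚ))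
        where
        e∉es : ∀ {g} → g List.∈ es → e ≢ g
        e∉es g∈es refl with walk-to-tail p g∈es
        ... | ps , q = ⊏-irrefl (e , ps , cons e refl q)
      ... | no f≢e = trans (χ≡cnt p f) (sym (trans (cong (_+ cnt es f) (δ-≢ (f≢e ∘ sym))) (+-identityˡ (cnt es f))))

      -- Trace the flow backwards. Positive outflow at a node other than s forces positive inflow,
      -- hence an entering arc with positive value, whose tail is strictly earlier.
      reach-source : ∀ {s t x} → Xflow G s t x → ∀ v → Acc _⊏_ v → 0ℚ < outflow G x v → Reach s v
      reach-source {s} {t} {x} flow@(x≥0 , cons-x , _ , in-t) v (acc rec) out>0 with v ≟ s
      ... | yes refl = [] , nil
      ... | no v≢s with through-pos⁻¹ (head G) v in>0
        where
        in>0 : 0ℚ < inflow G x v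
        in>0 with v ≟ t
        -- At t the inflow exceeds the outflow by one, so it is positive as well.
        ... | yes refl = subst (0ℚ <_) (sym in-t) (ℚₚ.+-mono-< out>0 (ℚₚ.positive⁻¹ 1ℚ))
        ... | no v≢t = subst (0ℚ <_) (cons-x v v≢s v≢t) out>0
      ...   | e , refl , xe>0 with reach-source flow (tail G e) (rec (e , [] , cons e refl nil)) (through-pos (tail G) x≥0 e xe>0)
      ...     | ps , p = _ , p ++ʷ cons e refl nil

      reach-target : ∀ {s t x} → Xflow G s t x → ∀ v → Acc (flip _⊏_) v → 0ℚ < inflow G x v → Reach v t
      reach-target {s} {t} {x} flow@(x≥0 , cons-x , out-s , _) v (acc rec) in>0 with v ≟ t
      ... | yes refl = [] , nil
      ... | no v≢t with through-pos⁻¹ (tail G) v out>0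
        where
        out>0 : 0ℚ < outflow G x v
        out>0 with v ≟ s
        ... | yes refl = subst (0ℚ <_) (sym out-s) (ℚₚ.+-mono-< in>0 (ℚₚ.positive⁻¹ 1ℚ))
        ... | no v≢s = subst (0ℚ <_) (sym (cons-x v v≢s v≢t)) in>0
      ...   | e , refl , xe>0 with reach-target flow (head G e) (rec (e , [] , cons e refl nil)) (through-pos (head G) x≥0 e xe>0)
      ...     | ps , p = _ , cons e refl p

      support-on-walk : ∀ {s t x} → Xflow G s t x → ∀ e → x e ≢ 0ℚ → Reach s (tail G e) × Reach (head G e) t
      support-on-walk {x = x} flow@(x≥0 , _) e xe≢0 =
        reach-source flow _ (⊏-wellFounded _) (through-pos (tail G) x≥0 e xe>0) ,
        reach-target flow _ (⊐-wellFounded _) (through-pos (head G) x≥0 e xe>0)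
        where
        xe>0 : 0ℚ < x e
        xe>0 with ℚₚ.<-cmp 0ℚ (x e)
        ... | tri< lt _ _ = lt
        ... | tri≈ _ eq _ = contradiction (sym eq) xe≢0
        ... | tri> _ _ gt = contradiction (ℚₚ.<-≤-trans gt (x≥0 e)) (ℚₚ.<-irrefl refl)

      difference-support-on-walk : ∀ {s t x x′} → Xflow G s t x → Xflow G s t x′ → ∀ e → x e - x′ e ≢ 0ℚ →
        Reach s (tail G e) × Reach (head G e) t
      difference-support-on-walk {x = x} {x′} flow flow′ e z≢0 with x e ℚₚ.≟ 0ℚ | x′ e ℚₚ.≟ 0ℚ
      ... | no xe≢0 | _ = support-on-walk flow e xe≢0
      ... | yes _ | no x′e≢0 = support-on-walk flow′ e x′e≢0
      ... | yes eq | yes eq′ = contradiction (x≡y⇒x-y≡0 (trans eq (sym eq′))) z≢0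

      -- Walks avoiding an identifying set

      Avoiding : Subset (m G) → V → V → List E → Set
      Avoiding S u v es = Walk G u v es × All (_∉ S) es

      -- Extend both walks by the same walk from s and the same walk to t. The resulting paths agree
      -- on S, since their middle parts avoid it, so they have the same incidence vector; the common
      -- parts cancel.
      avoiding-unique : ∀ {s t S u v es es′} → Identifying G (Xpath G s t) S → Reach s u → Reach v t →
        Avoiding S u v es → Avoiding S u v es′ → ∀ f → cnt es f ≡ cnt es′ f
      avoiding-unique {s} {t} {S} {u} {v} {es} {es′} ident (ps , p) (qs , q) (w , avoids) (w′ , avoids′) f =
        decidable-stable (cnt es f ℚₚ.≟ cnt es′ f) λ differ →
          let e , e∈S , differ-e = ident _ _ (path w) (path w′) (λ same → differ (cancel f (same f)))
          in differ-e (extend e (trans (vanishes avoids e∈S) (sym (vanishes avoids′ e∈S))))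
        where
        through-walk : ∀ {es} → Walk G u v es → Walk G s t (ps ++ es ++ qs)
        through-walk w = p ++ʷ (w ++ʷ q)
        path : ∀ {es} → Walk G u v es → Xpath G s t (χ G (ps ++ es ++ qs))
        path {es} w = _ , (through-walk w , walk-unique (through-walk w)) , λ _ → refl
        expand : ∀ {es} → Walk G u v es → ∀ e → χ G (ps ++ es ++ qs) e ≡ cnt ps e + (cnt es e + cnt qs e)
        expand {es} w e = trans (χ≡cnt (through-walk w) e) (trans (cnt-++ ps (es ++ qs) e) (cong (cnt ps e +_) (cnt-++ es qs e)))
        extend : ∀ e → cnt es e ≡ cnt es′ e → χ G (ps ++ es ++ qs) e ≡ χ G (ps ++ es′ ++ qs) e
        extend e eq = trans (expand w e) (trans (cong (λ a → cnt ps e + (a + cnt qs e)) eq) (sym (expand w′ e)))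
        cancel : ∀ e → χ G (ps ++ es ++ qs) e ≡ χ G (ps ++ es′ ++ qs) e → cnt es e ≡ cnt es′ e
        cancel e eq = begin
          cnt es e   ≡⟨ isolate (cnt ps e) (cnt es e) (cnt qs e) ⟩
          (cnt ps e + (cnt es e + cnt qs e)) - (cnt ps e + cnt qs e)
            ≡⟨ cong (_- (cnt ps e + cnt qs e)) (trans (sym (expand w e)) (trans eq (expand w′ e))) ⟩
          (cnt ps e + (cnt es′ e + cnt qs e)) - (cnt ps e + cnt qs e)  ≡⟨ isolate (cnt ps e) (cnt es′ e) (cnt qs e) ⟨
          cnt es′ e ∎
          where
          isolate : ∀ a b c → b ≡ (a + (b + c)) - (a + c)
          isolate = solve 3 (λ a b c → b := (a :+ (b :+ c)) :- (a :+ c)) refl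
        vanishes : ∀ {es e} → All (_∉ S) es → e ∈ S → cnt es e ≡ 0ℚ
        vanishes avoids e∈S = cnt-∉ (All.map (λ { f∉S refl → f∉S e∈S }) avoids)

  -- The upper bound

  pairs : ∀ {A : Set} → List A → List (A × A)
  pairs [] = []
  pairs (x ∷ xs) = map (x ,_) xs ++ pairs xs

  -- Doubled so that the binomial coefficient needs no division.
  2*length-pairs : ∀ {A : Set} (x : A) xs → 2 ℕ.* length (pairs (x ∷ xs)) ≡ suc (length xs) ℕ.* length xs
  2*length-pairs x [] = refl
  2*length-pairs x xs@(y ∷ ys) = begin
    2 ℕ.* length (map (x ,_) xs ++ pairs xs)                ≡⟨ cong (2 ℕ.*_) (length-++ (map (x ,_) xs)) ⟩
    2 ℕ.* (length (map (x ,_) xs) ℕ.+ length (pairs xs))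
      ≡⟨ ℕ.*-distribˡ-+ 2 (length (map (x ,_) xs)) (length (pairs xs)) ⟩
    2 ℕ.* length (map (x ,_) xs) ℕ.+ 2 ℕ.* length (pairs xs)
      ≡⟨ cong₂ (λ a b → 2 ℕ.* a ℕ.+ b) (length-map (x ,_) xs) (2*length-pairs y ys) ⟩
    2 ℕ.* suc l ℕ.+ suc l ℕ.* l
      ≡⟨ solveℕ 1 (λ l → lit 2 ⊛ (lit 1 ⊕ l) ⊕ (lit 1 ⊕ l) ⊛ l ≔ (lit 2 ⊕ l) ⊛ (lit 1 ⊕ l)) refl l ⟩
    suc (suc l) ℕ.* suc l ∎
    where l = length ys

  ∈-pairs : ∀ {A : Set} {x y : A} {xs} → x List.∈ xs → y List.∈ xs → x ≢ y → (x , y) List.∈ pairs xs ⊎ (y , x) List.∈ pairs xs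
  ∈-pairs (here refl) (here refl) x≢y = contradiction refl x≢y
  ∈-pairs (here refl) (there y∈) _ = inj₁ (∈-++⁺ˡ (∈-map⁺ _ y∈))
  ∈-pairs (there x∈) (here refl) _ = inj₂ (∈-++⁺ˡ (∈-map⁺ _ x∈))
  ∈-pairs {xs = z ∷ zs} (there x∈) (there y∈) x≢y with ∈-pairs x∈ y∈ x≢y
  ... | inj₁ p = inj₁ (∈-++⁺ʳ (map (z ,_) zs) p)
  ... | inj₂ p = inj₂ (∈-++⁺ʳ (map (z ,_) zs) p)

  elements : ∀ {k} → Subset k → List (Fin k)
  elements [] = []
  elements (outside ∷ p) = map suc (elements p)
  elements (inside ∷ p) = zero ∷ map suc (elements p)

  length-elements : ∀ {k} (p : Subset k) → length (elements p) ≡ ∣ p ∣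
  length-elements [] = refl
  length-elements (outside ∷ p) = trans (length-map suc (elements p)) (length-elements p)
  length-elements (inside ∷ p) = cong suc (trans (length-map suc (elements p)) (length-elements p))

  ∈-elements : ∀ {k} {p : Subset k} {x} → x ∈ p → x List.∈ elements p
  ∈-elements here = here refl
  ∈-elements {p = outside ∷ p} (there x∈p) = ∈-map⁺ suc (∈-elements x∈p)
  ∈-elements {p = inside ∷ p} (there x∈p) = there (∈-map⁺ suc (∈-elements x∈p))

  -- Finitely many instances of excluded middle can be collected under one double negation.
  ¬¬-decidable : ∀ {k} {P : Fin k → Set} → ¬ ¬ (∀ i → Dec (P i))
  ¬¬-decidable = sequence (RawMonad.rawApplicative ¬¬-Monad) (λ _ → ¬¬-excluded-middle)

  module UpperBound (G : Digraph) (acyclic : Acyclic G) (s t : Fin (n G)) (S : Subset (m G))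
    (identifying : Identifying G (Xpath G s t) S) where

    open Graph G
    open Dag acyclic

    private
      V = Fin (n G)
      E = Fin (m G)

    AvoidingReach : V → V → Set
    AvoidingReach u v = ∃ λ es → Avoiding S u v es

    ReachViaS : V → Set
    ReachViaS v = ∃ λ j → j ∈ S × AvoidingReach v (tail G j) × Reach (head G j) t

    cons-avoiding : ∀ {u v es} e → e ∉ S → tail G e ≡ u → Avoiding S (head G e) v es → Avoiding S u v (e ∷ es)
    cons-avoiding e e∉S eq (w , avoids) = cons e eq w , e∉S ∷ avoids

    _++ᵃ_ : ∀ {u v w es fs} → Avoiding S u v es → Avoiding S v w fs → Avoiding S u w (es ++ fs)
    (w , avoids) ++ᵃ (w′ , avoids′) = w ++ʷ w′ , All.++⁺ avoids avoids′

    first-S-arc : ∀ {v es} → Walk G v t es → AvoidingReach v t ⊎ ReachViaS v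
    first-S-arc nil = inj₁ ([] , nil , [])
    first-S-arc (cons e refl p) with e ∈? S
    ... | yes e∈S = inj₂ (e , e∈S , ([] , nil , []) , (_ , p))
    ... | no e∉S with first-S-arc p
    ...   | inj₁ (es , a) = inj₁ (e ∷ es , cons-avoiding e e∉S refl a)
    ...   | inj₂ (j , j∈S , (es , a) , r) = inj₂ (j , j∈S , (e ∷ es , cons-avoiding e e∉S refl a) , r)

    last-S-arc : ∀ {u v es} → Walk G u v es →
      AvoidingReach u v ⊎ (∃ λ i → i ∈ S × Reach u (tail G i) × AvoidingReach (head G i) v)
    last-S-arc nil = inj₁ ([] , nil , [])
    last-S-arc (cons e refl p) with last-S-arc p
    ... | inj₂ (i , i∈S , (ps , q) , a) = inj₂ (i , i∈S , (e ∷ ps , cons e refl q) , a)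
    ... | inj₁ (es , a) with e ∈? S
    ...   | yes e∈S = inj₂ (e , e∈S , ([] , nil) , (es , a))
    ...   | no e∉S = inj₁ (e ∷ es , cons-avoiding e e∉S refl a)

    -- `nothing` stands for s among the sources and for t among the targets.
    source target : Maybe E → V
    source nothing = s
    source (just i) = head G i
    target nothing = t
    target (just j) = tail G j

    -- Sources must be reachable from s and targets must reach t: these are the conditions under
    -- which `avoiding-unique` applies to a walk between them.
    ValidSource ValidTarget : Maybe E → Set
    ValidSource o = Reach s (source o) × (∀ i → o ≡ just i → i ∈ S)
    ValidTarget nothing = ⊤
    ValidTarget (just j) = j ∈ S × Reach (head G j) t

    target-reaches : ∀ o → ValidTarget o → Reach (target o) t
    target-reaches nothing _ = [] , nil
    target-reaches (just j) (_ , qs , q) = j ∷ qs , cons j refl q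

    -- Cut the walk after its last arc of S, or at s if it has none.
    entry : ∀ {v} → Reach s v → ∃ λ o → ValidSource o × AvoidingReach (source o) v
    entry (es , w) with last-S-arc w
    ... | inj₁ a = nothing , (([] , nil) , λ _ ()) , a
    ... | inj₂ (i , i∈S , (ps , p) , a) = just i , ((_ , p ++ʷ cons i refl nil) , λ { _ refl → i∈S }) , a

    -- Potentials and the generators of all flow differences

    module _ (reach? : ∀ u v → Dec (AvoidingReach u v)) (reachesS? : ∀ v → Dec (ReachViaS v)) where

      potential-acc : ∀ v → Acc (flip _⊏_) v → Vect G
      potential-acc v (acc rec) f with reach? v t
      ... | yes (es , _) = cnt es f
      ... | no _ with reachesS? v
      -- A default: by `first-S-arc`, such a node does not reach t.
      ...   | no _ = 0ℚ
      ...   | yes (j , _ , (es , w , _) , _) =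
        cnt es f + (δ j f + potential-acc (head G j) (rec (reach-arc⇒⊏ j (es , w) ([] , nil))) f)

      -- Needed to unfold `potential`: the recursive call carries an accessibility proof other than
      -- `⊐-wellFounded (head G j)`.
      potential-acc-irrelevant : ∀ v a b f → potential-acc v a f ≡ potential-acc v b f
      potential-acc-irrelevant v (acc rec) (acc rec′) f with reach? v t
      ... | yes _ = refl
      ... | no _ with reachesS? v
      ...   | no _ = refl
      ...   | yes (j , _ , (es , w , _) , _) =
        cong (λ a → cnt es f + (δ j f + a)) (potential-acc-irrelevant (head G j) (rec j⊐v) (rec′ j⊐v) f)
        where j⊐v = reach-arc⇒⊏ j (es , w) ([] , nil)

      -- The arc vector of a chosen walk from v to t, which avoids S whenever that is possible.
      potential : V → Vect G
      potential v = potential-acc v (⊐-wellFounded v)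

      -- What the chosen walk contributes after its initial S-avoiding stretch, which ends either at
      -- t or at the tail of `j`.
      remainder : Maybe E → Vect G
      remainder nothing f = 0ℚ
      remainder (just j) f = δ j f + potential (head G j) f

      potential-expansion : ∀ v → Reach v t → ∃ λ o → ∃ λ es →
        ValidTarget o × Avoiding S v (target o) es × (∀ f → potential v f ≡ cnt es f + remainder o f)
      potential-expansion v r with ⊐-wellFounded v
      ... | acc rec with reach? v t
      ...   | yes (es , a) = nothing , es , tt , a , λ f → sym (+-identityʳ (cnt es f))
      ...   | no ¬direct with reachesS? v
      ...     | yes (j , j∈S , (es , a) , r′) = just j , es , (j∈S , r′) , a ,
        λ f → cong (λ b → cnt es f + (δ j f + b))
          (potential-acc-irrelevant (head G j) (rec (reach-arc⇒⊏ j (es , proj₁ a) ([] , nil))) (⊐-wellFounded (head G j)) f)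
      ...     | no ¬via with first-S-arc (proj₂ r)
      ...       | inj₁ direct = contradiction direct ¬direct
      ...       | inj₂ via = contradiction via ¬via

      potential-direct : ∀ {v es} → Reach s v → Avoiding S v t es → ∀ f → potential v f ≡ cnt es f
      potential-direct {v} r a f with ⊐-wellFounded v
      ... | acc rec with reach? v t
      ...   | yes (es′ , a′) = avoiding-unique identifying r ([] , nil) a′ a f
      ...   | no ¬direct = contradiction (_ , a) ¬direct

      -- The vector c(u,j) for the source u, with the default zero if no S-avoiding walk leads from
      -- u to the tail of `j`.
      generator : Maybe E → E → Vect G
      generator o j f with reach? (source o) (tail G j)
      ... | yes (es , _) = cnt es f + remainder (just j) f - potential (source o) f
      ... | no _ = 0ℚ

      -- `generator` uses whichever walk `reach?` returns; by `avoiding-unique` every other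
      -- S-avoiding walk gives the same vector.
      generator-expansion : ∀ o j {es} → ValidSource o → ValidTarget (just j) → Avoiding S (source o) (tail G j) es →
        ∀ f → generator o j f ≡ cnt es f + remainder (just j) f - potential (source o) f
      generator-expansion o j (r , _) valid a f with reach? (source o) (tail G j)
      ... | yes (es′ , a′) = cong (λ b → b + remainder (just j) f - potential (source o) f)
                               (avoiding-unique identifying r (target-reaches (just j) valid) a′ a f)
      ... | no unreachable = contradiction (_ , a) unreachable

      -- Acyclicity leaves only one of the two directions between a pair of arcs, so one vector per pair suffices.
      generator-pair : Maybe E × Maybe E → Vect G
      generator-pair (nothing , nothing) = λ _ → 0ℚ
      generator-pair (nothing , just j) = generator nothing j
      generator-pair (just i , nothing) = generator nothing i
      generator-pair (just i , just j) =
        if does (reach? (head G i) (tail G j)) then generator (just i) j else generator (just j) i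

      sources : List (Maybe E)
      sources = nothing ∷ map just (elements S)

      generators : List (Vect G)
      generators = map generator-pair (pairs sources)

      2*length-generators : 2 ℕ.* length generators ≡ suc ∣ S ∣ ℕ.* ∣ S ∣
      2*length-generators = begin
        2 ℕ.* length generators        ≡⟨ cong (2 ℕ.*_) (length-map generator-pair (pairs sources)) ⟩
        2 ℕ.* length (pairs sources)   ≡⟨ 2*length-pairs nothing (map just (elements S)) ⟩
        suc (length (map just (elements S))) ℕ.* length (map just (elements S))
          ≡⟨ cong (λ l → suc l ℕ.* l) (trans (length-map just (elements S)) (length-elements S)) ⟩
        suc ∣ S ∣ ℕ.* ∣ S ∣ ∎

      Span-generator : ∀ o j → (∀ i → o ≡ just i → i ∈ S) → j ∈ S → AvoidingReach (source o) (tail G j) →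
        Span generators (generator o j)
      Span-generator nothing j _ j∈S a with ∈-pairs {xs = sources} (here refl) (there (∈-map⁺ just (∈-elements j∈S))) (λ ())
      ... | inj₁ p = Span-∈ (∈-map⁺ generator-pair p)
      ... | inj₂ p = Span-∈ (∈-map⁺ generator-pair p)
      Span-generator (just i) j i∈S j∈S a@(es , w , _)
        with ∈-pairs {xs = sources} (there (∈-map⁺ just (∈-elements (i∈S i refl)))) (there (∈-map⁺ just (∈-elements j∈S))) i≢j
        where
        i≢j : just i ≢ just j
        i≢j refl = ⊏-irrefl (reach-arc⇒⊏ i (es , w) ([] , nil))
      ... | inj₁ p = subst (λ b → Span generators (if b then generator (just i) j else generator (just j) i))
                       (dec-true (reach? (head G i) (tail G j)) a) (Span-∈ (∈-map⁺ generator-pair p))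
      -- The pair is listed as (j, i), and `generator-pair` first tries the direction from `j` to
      -- `i`. That would close a cycle, so the test fails and the wanted generator is selected.
      ... | inj₂ p = subst (λ b → Span generators (if b then generator (just j) i else generator (just i) j))
                       (dec-false (reach? (head G j) (tail G i)) backwards) (Span-∈ (∈-map⁺ generator-pair p))
        where
        backwards : ¬ AvoidingReach (head G j) (tail G i)
        backwards (fs , w′ , _) = ⊏-irrefl (⊏-trans (reach-arc⇒⊏ j (es , w) ([] , nil)) (reach-arc⇒⊏ i (fs , w′) ([] , nil)))

      -- A segment that ends at t is the walk counted by `potential (source o)`, by uniqueness, and
      -- gives the zero vector. A segment that ends at an arc of S is a generator.
      Span-segment : ∀ o o′ {es} → ValidSource o → ValidTarget o′ → Avoiding S (source o) (target o′) es →
        Span generators (λ f → cnt es f + remainder o′ f - potential (source o) f)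
      Span-segment o nothing {es} (r , _) _ a = Span-zero generators λ f →
        x≡y⇒x-y≡0 (trans (+-identityʳ (cnt es f)) (sym (potential-direct r a f)))
      Span-segment o (just j) vs@(_ , o∈S) vt@(j∈S , _) a =
        Span-resp generators (generator-expansion o j vs vt a) (Span-generator o j o∈S j∈S (_ , a))

      -- Take an S-avoiding walk from a source to the tail of `e`. Two segments start with it: one
      -- follows the potential at the tail, the other uses `e`. The second stops at `e` if `e ∈ S`
      -- and otherwise goes on along the potential at the head. In their difference the common walk
      -- and the potential of the source cancel.
      Span-arc : ∀ e → Reach s (tail G e) → Reach (head G e) t →
        Span generators (λ f → δ e f + potential (head G e) f - potential (tail G e) f)
      Span-arc e from to@(qs , q) with entry from | potential-expansion (tail G e) (e ∷ qs , cons e refl q) | e ∈? S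
      ... | o , vo , (ps , p) | o₁ , es₁ , v₁ , a₁ , eq₁ | yes e∈S =
        Span-resp generators (λ f → begin
          (cnt ps f + (δ e f + H f) - Q₀ f) - (cnt (ps ++ es₁) f + remainder o₁ f - Q₀ f)
            ≡⟨ cong (λ a → (cnt ps f + (δ e f + H f) - Q₀ f) - (a + remainder o₁ f - Q₀ f)) (cnt-++ ps es₁ f) ⟩
          (cnt ps f + (δ e f + H f) - Q₀ f) - ((cnt ps f + cnt es₁ f) + remainder o₁ f - Q₀ f)
            ≡⟨ solve 6 (λ p d h q c r → (p :+ (d :+ h) :- q) :- ((p :+ c) :+ r :- q) := d :+ h :- (c :+ r)) refl
                 (cnt ps f) (δ e f) (H f) (Q₀ f) (cnt es₁ f) (remainder o₁ f) ⟩
          δ e f + H f - (cnt es₁ f + remainder o₁ f)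
            ≡⟨ cong (λ a → δ e f + H f - a) (eq₁ f) ⟨
          δ e f + H f - potential (tail G e) f ∎)
        (Span-sub generators (Span-segment o (just e) vo (e∈S , to) p) (Span-segment o o₁ vo v₁ (p ++ᵃ a₁)))
        where
        H = potential (head G e)
        Q₀ = potential (source o)
      ... | o , vo , (ps , p) | o₁ , es₁ , v₁ , a₁ , eq₁ | no e∉S with potential-expansion (head G e) to
      ...   | o₂ , es₂ , v₂ , a₂ , eq₂ =
        Span-resp generators (λ f → begin
          (cnt (ps ++ e ∷ es₂) f + remainder o₂ f - Q₀ f) - (cnt (ps ++ es₁) f + remainder o₁ f - Q₀ f)
            ≡⟨ cong₂ (λ a b → (a + remainder o₂ f - Q₀ f) - (b + remainder o₁ f - Q₀ f)) (cnt-++ ps (e ∷ es₂) f) (cnt-++ ps es₁ f) ⟩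
          ((cnt ps f + (δ e f + cnt es₂ f)) + remainder o₂ f - Q₀ f) - ((cnt ps f + cnt es₁ f) + remainder o₁ f - Q₀ f)
            ≡⟨ solve 7 (λ p d c₂ r₂ q c₁ r₁ → ((p :+ (d :+ c₂)) :+ r₂ :- q) :- ((p :+ c₁) :+ r₁ :- q) := d :+ (c₂ :+ r₂) :- (c₁ :+ r₁)) refl
                 (cnt ps f) (δ e f) (cnt es₂ f) (remainder o₂ f) (Q₀ f) (cnt es₁ f) (remainder o₁ f) ⟩
          δ e f + (cnt es₂ f + remainder o₂ f) - (cnt es₁ f + remainder o₁ f)
            ≡⟨ cong₂ (λ a b → δ e f + a - b) (eq₂ f) (eq₁ f) ⟨
          δ e f + potential (head G e) f - potential (tail G e) f ∎)
        (Span-sub generators (Span-segment o o₂ vo v₂ (p ++ᵃ cons-avoiding e e∉S refl a₂))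
          (Span-segment o o₁ vo v₁ (p ++ᵃ a₁)))
        where
        Q₀ = potential (source o)

      Span-flow-difference : ∀ {x x′} → Xflow G s t x → Xflow G s t x′ → Span generators (λ e → x e - x′ e)
      Span-flow-difference {x} {x′} flow flow′ =
        Span-resp generators (λ f → sym (circulation-expansion (flow-difference flow flow′) potential f))
          (Span-∑ generators (λ e → x e - x′ e) _ λ e z≢0 →
            let from , to = difference-support-on-walk flow flow′ e z≢0 in Span-arc e from to)

      small-identifying : ∃ λ T → Identifying G (Xflow G s t) T × 2 ℕ.* ∣ T ∣ ℕ.≤ suc ∣ S ∣ ℕ.* ∣ S ∣
      small-identifying with detecting-coordinates generators
      ... | T , T≤ , detects = T , T-identifying , ℕ.≤-trans (ℕ.*-monoʳ-≤ 2 T≤) (ℕ.≤-reflexive 2*length-generators)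
        where
        T-identifying : Identifying G (Xflow G s t) T
        T-identifying x x′ flow flow′ differ with any? (λ e → (e ∈? T) ×-dec ¬? (x e ℚₚ.≟ x′ e))
        ... | yes found = found
        ... | no none = contradiction
          (λ e → x-y≡0⇒x≡y (detects (λ e → x e - x′ e) (Span-flow-difference flow flow′) agree e)) differ
          where
          agree : ∀ e → e ∈ T → x e - x′ e ≡ 0ℚ
          agree e e∈T = x≡y⇒x-y≡0 (decidable-stable (x e ℚₚ.≟ x′ e) (λ x≢x′ → none (e , e∈T , x≢x′)))

    -- The construction needs decisions about reachability. They are available under double
    -- negation, which is enough because the bound is a decidable inequality.
    flow-minimum-bound : ∀ (S′ : Subset (m G)) → (∀ T → Identifying G (Xflow G s t) T → ∣ S′ ∣ ℕ.≤ ∣ T ∣) →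
      2 ℕ.* ∣ S′ ∣ ℕ.≤ suc ∣ S ∣ ℕ.* ∣ S ∣
    flow-minimum-bound S′ minimal = decidable-stable (2 ℕ.* ∣ S′ ∣ ℕ.≤? suc ∣ S ∣ ℕ.* ∣ S ∣) λ exceeds →
      ¬¬-decidable² λ reach? → ¬¬-decidable λ reachesS? →
        let T , T-identifying , T≤ = small-identifying reach? reachesS?
        in exceeds (ℕ.≤-trans (ℕ.*-monoʳ-≤ 2 (minimal T T-identifying)) T≤)
      where
      ¬¬-decidable² : ¬ ¬ (∀ u v → Dec (AvoidingReach u v))
      ¬¬-decidable² = sequence (RawMonad.rawApplicative ¬¬-Monad) (λ _ → ¬¬-decidable)

  -- Lower bound on identifying sets for flows

  *-pos : ∀ {p q} → 0ℚ < p → 0ℚ < q → 0ℚ < p * q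
  *-pos {p} {q} p>0 q>0 = ℚₚ.positive⁻¹ (p * q) {{ℚₚ.pos*pos⇒pos p {{positive p>0}} q {{positive q>0}}}}

  *-nonNeg : ∀ {p q} → 0ℚ ≤ p → 0ℚ ≤ q → 0ℚ ≤ p * q
  *-nonNeg {p} {q} p≥0 q≥0 =
    ℚₚ.nonNegative⁻¹ (p * q) {{ℚₚ.nonNeg*nonNeg⇒nonNeg p {{nonNegative p≥0}} q {{nonNegative q≥0}}}}

  reciprocal : ∀ {p} → 0ℚ < p → ∃ λ q → 0ℚ < q × q * p ≡ 1ℚ
  reciprocal {p} p>0 = 1/ p , ℚₚ.positive⁻¹ (1/ p) {{ℚₚ.1/pos⇒pos p}} , ℚₚ.*-inverseˡ p
    where instance
      _ = positive p>0
      _ = ℚₚ.pos⇒nonZero p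

  -- A negative coordinate of `z` requires a factor of at least `- z i` divided by `x i`. Adding up
  -- these demands replaces taking their maximum.
  dominating-multiple : ∀ {k} (x z : Fin k → ℚ) → (∀ i → 0ℚ < x i) → ∃ λ a → 0ℚ < a × (∀ i → 0ℚ ≤ a * x i + z i)
  dominating-multiple {zero} x z x>0 = 1ℚ , ℚₚ.positive⁻¹ 1ℚ , λ ()
  dominating-multiple {suc k} x z x>0
    with dominating-multiple (x ∘ suc) (z ∘ suc) (x>0 ∘ suc) | 0ℚ ℚₚ.≤? z zero
  ... | a , a>0 , dom | yes z≥0 = a , a>0 , λ
    { zero → ℚₚ.+-mono-≤ (*-nonNeg (ℚₚ.<⇒≤ a>0) (ℚₚ.<⇒≤ (x>0 zero))) z≥0
    ; (suc i) → dom i }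
  ... | a , a>0 , dom | no z≱0 with reciprocal (x>0 zero)
  ...   | r , r>0 , rx≡1 = b * r + a , ℚₚ.+-mono-< (*-pos b>0 r>0) a>0 , dom′
    where
    b = - z zero
    b>0 : 0ℚ < b
    b>0 = ℚₚ.neg-antimono-< (ℚₚ.≰⇒> z≱0)
    dom′ : ∀ i → 0ℚ ≤ (b * r + a) * x i + z i
    dom′ zero = subst (0ℚ ≤_) (sym (begin
      (b * r + a) * x zero + z zero
        ≡⟨ solve 4 (λ z r a x → (:- z :* r :+ a) :* x :+ z := (:- z :* (r :* x) :+ z) :+ a :* x) refl (z zero) r a (x zero) ⟩
      (b * (r * x zero) + z zero) + a * x zero ≡⟨ cong (λ c → (b * c + z zero) + a * x zero) rx≡1 ⟩
      (b * 1ℚ + z zero) + a * x zero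
        ≡⟨ solve 2 (λ z y → (:- z :* con 1ℚ :+ z) :+ y := y) refl (z zero) (a * x zero) ⟩
      a * x zero ∎)) (*-nonNeg (ℚₚ.<⇒≤ a>0) (ℚₚ.<⇒≤ (x>0 zero)))
    dom′ (suc i) = subst (0ℚ ≤_)
      (solve 5 (λ b r a x z → (b :* r) :* x :+ (a :* x :+ z) := (b :* r :+ a) :* x :+ z) refl b r a (x (suc i)) (z (suc i)))
      (ℚₚ.+-mono-≤ (*-nonNeg (ℚₚ.<⇒≤ (*-pos b>0 r>0)) (ℚₚ.<⇒≤ (x>0 (suc i)))) (dom i))

  -- The differences sum to zero and vanish away from `r`, so the one at `r` vanishes too. This
  -- recovers the balance at a node from the balances at all others.
  equal-sums : ∀ {k} (f g : Fin k → ℚ) r → ∑ f ≡ ∑ g → (∀ v → v ≢ r → f v ≡ g v) → f r ≡ g r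
  equal-sums f g r sums agree = x-y≡0⇒x≡y (begin
    f r - g r                        ≡⟨ ∑-δ r (λ v → f v - g v) ⟨
    ∑ (λ v → δ r v * (f v - g v))    ≡⟨ ∑-cong pointwise ⟩
    ∑ (λ v → f v - g v)              ≡⟨ ∑-sub f g ⟩
    ∑ f - ∑ g                        ≡⟨ x≡y⇒x-y≡0 sums ⟩
    0ℚ ∎)
    where
    pointwise : ∀ v → δ r v * (f v - g v) ≡ f v - g v
    pointwise v with v ≟ r
    ... | yes refl = trans (cong (_* (f v - g v)) (δ-refl v)) (*-identityˡ (f v - g v))
    ... | no v≢r = trans (cong (_* (f v - g v)) (δ-≢ (v≢r ∘ sym)))
                     (trans (*-zeroˡ (f v - g v)) (sym (x≡y⇒x-y≡0 (agree v v≢r))))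

  module LowerBound (G : Digraph) {s t : Fin (n G)} {x : Vect G} (flow : Xflow G s t x) (x>0 : ∀ e → 0ℚ < x e) where

    open Graph G

    private
      E = Fin (m G)

    -- The row of the node-arc incidence matrix that belongs to `v`.
    imbalance : Fin (n G) → E → ℚ
    imbalance v e = δ (tail G e) v - δ (head G e) v

    ∑-imbalance : ∀ z v → ∑ (λ e → z e * imbalance v e) ≡ outflow G z v - inflow G z v
    ∑-imbalance z v = begin
      ∑ (λ e → z e * imbalance v e)
        ≡⟨ ∑-cong (λ e → solve 3 (λ z a b → z :* (a :- b) := a :* z :- b :* z) refl (z e) (δ (tail G e) v) (δ (head G e) v)) ⟩
      ∑ (λ e → δ (tail G e) v * z e - δ (head G e) v * z e)
        ≡⟨ ∑-sub (λ e → δ (tail G e) v * z e) (λ e → δ (head G e) v * z e) ⟩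
      ∑ (λ e → δ (tail G e) v * z e) - ∑ (λ e → δ (head G e) v * z e)
        ≡⟨ cong₂ _-_ (through-δ (tail G) z v) (through-δ (head G) z v) ⟨
      outflow G z v - inflow G z v ∎

    perturbed-flow : ∀ {z} → Circulation z → ∀ b → (∀ e → 0ℚ ≤ x e + b * z e) → Xflow G s t (λ e → x e + b * z e)
    perturbed-flow {z} circ b x′≥0 =
      x′≥0 , (λ v v≢s v≢t → balance v (proj₁ (proj₂ flow) v v≢s v≢t)) ,
      trans (shifted-out s) (trans (cong₂ (λ a c → a + b * c) out-s (circ s))
        (trans (swap (inflow G x s) (inflow G z s)) (cong (_+ 1ℚ) (sym (shifted-in s))))) ,
      trans (shifted-in t) (trans (cong₂ (λ a c → a + b * c) in-t (sym (circ t)))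
        (trans (swap (outflow G x t) (outflow G z t)) (cong (_+ 1ℚ) (sym (shifted-out t)))))
      where
      out-s = proj₁ (proj₂ (proj₂ flow))
      in-t = proj₂ (proj₂ (proj₂ flow))
      shifted-out = through-linear (tail G) x b z
      shifted-in = through-linear (head G) x b z
      swap : ∀ p q → (p + 1ℚ) + b * q ≡ (p + b * q) + 1ℚ
      swap p q = solve 3 (λ p q b → (p :+ con 1ℚ) :+ b :* q := (p :+ b :* q) :+ con 1ℚ) refl p q b
      balance : ∀ v → outflow G x v ≡ inflow G x v →
        outflow G (λ e → x e + b * z e) v ≡ inflow G (λ e → x e + b * z e) v
      balance v eq = trans (shifted-out v) (trans (cong₂ (λ a c → a + b * c) eq (circ v)) (sym (shifted-in v)))

    -- A circulation vanishing on T solves ∣ T ∣ + (n − 1) equations, since conservation at s is redundant.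
    arcs≤identifying+nodes : ∀ T → Identifying G (Xflow G s t) T → m G ℕ.≤ ∣ T ∣ ℕ.+ (n G ℕ.∸ 1)
    arcs≤identifying+nodes T identifying = ℕ.≮⇒≥ λ fewer →
      absurd (homogeneous-solution equations (subst (ℕ._< m G) (sym size) fewer))
      where
      others = elements (∁ ⁅ s ⁆)
      equations = map δ (elements T) ++ map imbalance others
      size : length equations ≡ ∣ T ∣ ℕ.+ (n G ℕ.∸ 1)
      size = begin
        length equations  ≡⟨ length-++ (map δ (elements T)) ⟩
        length (map δ (elements T)) ℕ.+ length (map imbalance others)
          ≡⟨ cong₂ ℕ._+_ (trans (length-map δ (elements T)) (length-elements T))
               (trans (length-map imbalance others) (trans (length-elements (∁ ⁅ s ⁆))
                 (trans (∣∁p∣≡n∸∣p∣ ⁅ s ⁆) (cong (n G ℕ.∸_) (∣⁅x⁆∣≡1 s))))) ⟩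
        ∣ T ∣ ℕ.+ (n G ℕ.∸ 1) ∎
      absurd : ¬ (∃ λ z → (∃ λ e → z e ≢ 0ℚ) × All.All (λ f → ∑ (λ e → z e * f e) ≡ 0ℚ) equations)
      -- Scaling `a * x + z ≥ 0` by the reciprocal `b` of `a` gives `x + b * z ≥ 0`. The perturbed
      -- vector is thus a second flow, different from `x` but equal to it on `T`.
      absurd (z , (e₀ , z≢0) , solves) with dominating-multiple x z x>0
      ... | a , a>0 , dom with reciprocal a>0
      ...   | b , b>0 , ba≡1 = contradicted (identifying x (λ e → x e + b * z e) flow (perturbed-flow circ b x′≥0) λ same → z≢0 (begin
          z e₀                       ≡⟨ *-identityˡ (z e₀) ⟨
          1ℚ * z e₀                  ≡⟨ cong (_* z e₀) ba≡1 ⟨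
          b * a * z e₀
            ≡⟨ solve 4 (λ x b a z → b :* a :* z := a :* ((x :+ b :* z) :- x)) refl (x e₀) b a (z e₀) ⟩
          a * ((x e₀ + b * z e₀) - x e₀) ≡⟨ cong (a *_) (x≡y⇒x-y≡0 (sym (same e₀))) ⟩
          a * 0ℚ                     ≡⟨ *-zeroʳ a ⟩
          0ℚ ∎))
        where
        z-on-T : ∀ e → e ∈ T → z e ≡ 0ℚ
        z-on-T e e∈T = begin
          z e                    ≡⟨ ∑-δ e z ⟨
          ∑ (λ i → δ e i * z i)  ≡⟨ ∑-cong (λ i → *-comm (δ e i) (z i)) ⟩
          ∑ (λ i → z i * δ e i)  ≡⟨ All.lookup solves (∈-++⁺ˡ (∈-map⁺ δ (∈-elements e∈T))) ⟩
          0ℚ ∎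
        circ-others : ∀ v → v ≢ s → outflow G z v ≡ inflow G z v
        circ-others v v≢s = x-y≡0⇒x≡y (trans (sym (∑-imbalance z v))
          (All.lookup solves (∈-++⁺ʳ (map δ (elements T)) (∈-map⁺ imbalance (∈-elements (x∉p⇒x∈∁p (x≢y⇒x∉⁅y⁆ v≢s)))))))
        circ : Circulation z
        circ v with v ≟ s
        ... | no v≢s = circ-others v v≢s
        -- The balance at s is not among the equations. It follows because outflows and inflows have
        -- the same total, the sum over all arcs.
        ... | yes refl = equal-sums (outflow G z) (inflow G z) v
                           (trans (through-total (tail G) z) (sym (through-total (head G) z))) circ-others
        x′≥0 : ∀ e → 0ℚ ≤ x e + b * z e
        x′≥0 e = subst (0ℚ ≤_) (begin
          b * (a * x e + z e)
            ≡⟨ solve 4 (λ b a x z → b :* (a :* x :+ z) := b :* a :* x :+ b :* z) refl b a (x e) (z e) ⟩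
          b * a * x e + b * z e       ≡⟨ cong (λ c → c * x e + b * z e) ba≡1 ⟩
          1ℚ * x e + b * z e          ≡⟨ cong (_+ b * z e) (*-identityˡ (x e)) ⟩
          x e + b * z e ∎) (*-nonNeg (ℚₚ.<⇒≤ b>0) (dom e))
        contradicted : ¬ (∃ λ e → e ∈ T × x e ≢ x e + b * z e)
        contradicted (e , e∈T , differ) = differ (sym (begin
          x e + b * z e  ≡⟨ cong (λ c → x e + b * c) (z-on-T e e∈T) ⟩
          x e + b * 0ℚ   ≡⟨ solve 2 (λ x b → x :+ b :* con 0ℚ := x) refl (x e) b ⟩
          x e ∎))

  -- The extremal graphs

  double nodes arcs : ℕ → ℕ
  double zero = zero
  double (suc k) = suc (suc (double k))
  nodes k = suc (suc (double k))
  arcs zero = 1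
  arcs (suc k) = (2 ℕ.+ k) ℕ.+ suc (arcs k)

  odd-node : ∀ {k} → Fin (suc k) → Fin (nodes k)
  odd-node zero = suc zero
  odd-node {suc k} (suc j) = suc (suc (odd-node j))

  -- Order of the arcs in the step: the k + 2 arcs that leave the new a₀, then the new bridge b₀ →
  -- a₁, then the arcs of the smaller graph with nodes shifted by two.
  from to : ∀ k → Fin (arcs k) → Fin (nodes k)
  from-old to-old : ∀ k → Fin (suc (arcs k)) → Fin (nodes (suc k))
  from zero _ = zero
  from (suc k) e = [ (λ _ → zero) , from-old k ]′ (splitAt (2 ℕ.+ k) e)
  from-old k zero = suc zero
  from-old k (suc e) = suc (suc (from k e))
  to zero _ = suc zero
  to (suc k) e = [ odd-node , to-old k ]′ (splitAt (2 ℕ.+ k) e)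
  to-old k zero = suc (suc zero)
  to-old k (suc e) = suc (suc (to k e))

  -- Nodes a₀, b₀, a₁, b₁, …, a_k, b_k in this order, arcs a_i → b_j for i ≤ j, and the bridges b_i → a_{i+1}.
  -- Passing from k to k + 1 puts a new pair a₀, b₀ in front.
  extremal : ℕ → Digraph
  extremal k = record { n = nodes k ; m = arcs k ; tail = from k ; head = to k }

  last-node : ∀ k → Fin (nodes k)
  last-node zero = suc zero
  last-node (suc k) = suc (suc (last-node k))

  -- The inner arcs are a_i → b_j with 1 ≤ i ≤ j. In the step they are exactly the non-bridges of
  -- the shifted copy.
  bridges inner-arcs : ∀ k → Subset (arcs k)
  bridges zero = outside ∷ []
  bridges (suc k) = Vec.replicate (2 ℕ.+ k) outside Vec.++ inside ∷ bridges k
  inner-arcs zero = outside ∷ []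
  inner-arcs (suc k) = Vec.replicate (2 ℕ.+ k) outside Vec.++ outside ∷ ∁ (bridges k)

  data ArcView {k} : Fin (arcs (suc k)) → Set where
    fresh : (j : Fin (2 ℕ.+ k)) → ArcView (j ↑ˡ suc (arcs k))
    old : (e : Fin (suc (arcs k))) → ArcView ((2 ℕ.+ k) ↑ʳ e)

  arcView : ∀ {k} (e : Fin (arcs (suc k))) → ArcView e
  arcView {k} e with splitAt (2 ℕ.+ k) e in eq
  ... | inj₁ j = subst ArcView (splitAt⁻¹-↑ˡ eq) (fresh j)
  ... | inj₂ e′ = subst ArcView (splitAt⁻¹-↑ʳ {2 ℕ.+ k} eq) (old e′)

  from-fresh : ∀ k j → from (suc k) (j ↑ˡ suc (arcs k)) ≡ zero
  from-fresh k j = cong [ (λ _ → zero) , from-old k ]′ (splitAt-↑ˡ (2 ℕ.+ k) j (suc (arcs k)))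

  to-fresh : ∀ k j → to (suc k) (j ↑ˡ suc (arcs k)) ≡ odd-node j
  to-fresh k j = cong [ odd-node , to-old k ]′ (splitAt-↑ˡ (2 ℕ.+ k) j (suc (arcs k)))

  from-↑ʳ : ∀ k e → from (suc k) ((2 ℕ.+ k) ↑ʳ e) ≡ from-old k e
  from-↑ʳ k e = cong [ (λ _ → zero) , from-old k ]′ (splitAt-↑ʳ (2 ℕ.+ k) (suc (arcs k)) e)

  to-↑ʳ : ∀ k e → to (suc k) ((2 ℕ.+ k) ↑ʳ e) ≡ to-old k e
  to-↑ʳ k e = cong [ odd-node , to-old k ]′ (splitAt-↑ʳ (2 ℕ.+ k) (suc (arcs k)) e)

  -- Parity tells the nodes b_i (odd) from the nodes a_i (even).
  isOdd : ∀ {l} → Fin l → Bool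
  isOdd zero = false
  isOdd (suc zero) = true
  isOdd (suc (suc i)) = isOdd i

  odd-node-isOdd : ∀ {k} (j : Fin (suc k)) → isOdd (odd-node j) ≡ true
  odd-node-isOdd zero = refl
  odd-node-isOdd {suc k} (suc j) = odd-node-isOdd j

  odd-node-injective : ∀ {k} (i j : Fin (suc k)) → odd-node i ≡ odd-node j → i ≡ j
  odd-node-injective zero zero _ = refl
  odd-node-injective {suc k} zero (suc j) ()
  odd-node-injective {suc k} (suc i) zero ()
  odd-node-injective {suc k} (suc i) (suc j) eq = cong suc (odd-node-injective i j (suc-injective (suc-injective eq)))

  lookup-bridges : ∀ k e → lookup (bridges k) e ≡ isOdd (from k e)
  lookup-bridges zero zero = refl
  lookup-bridges (suc k) e with arcView e
  ... | fresh j rewrite from-fresh k j =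
    trans (lookup-++ˡ (Vec.replicate (2 ℕ.+ k) outside) (inside ∷ bridges k) j) (lookup-replicate j outside)
  ... | old zero rewrite from-↑ʳ k zero = lookup-++ʳ (Vec.replicate (2 ℕ.+ k) outside) (inside ∷ bridges k) zero
  ... | old (suc e′) rewrite from-↑ʳ k (suc e′) =
    trans (lookup-++ʳ (Vec.replicate (2 ℕ.+ k) outside) (inside ∷ bridges k) (suc e′)) (lookup-bridges k e′)

  parity-alternates : ∀ k e → isOdd (to k e) ≡ not (isOdd (from k e))
  parity-alternates zero zero = refl
  parity-alternates (suc k) e with arcView e
  ... | fresh j rewrite from-fresh k j | to-fresh k j = odd-node-isOdd j
  ... | old zero rewrite from-↑ʳ k zero | to-↑ʳ k zero = refl
  ... | old (suc e′) rewrite from-↑ʳ k (suc e′) | to-↑ʳ k (suc e′) = parity-alternates k e′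

  -- Used in both directions: the tail of a bridge determines its head, and its head determines its
  -- tail.
  bridge-step : ∀ k e → isOdd (from k e) ≡ true → toℕ (to k e) ≡ suc (toℕ (from k e))
  bridge-step (suc k) e odd with arcView e
  ... | fresh j = contradiction (trans (sym odd) (cong isOdd (from-fresh k j))) λ ()
  ... | old zero rewrite from-↑ʳ k zero | to-↑ʳ k zero = refl
  ... | old (suc e′) rewrite from-↑ʳ k (suc e′) | to-↑ʳ k (suc e′) = cong (2 ℕ.+_) (bridge-step k e′ odd)

  odd-node-positive : ∀ {k} (j : Fin (suc k)) → 0 ℕ.< toℕ (odd-node j)
  odd-node-positive zero = s≤s z≤n
  odd-node-positive {suc k} (suc j) = s≤s z≤n

  from<to : ∀ k e → toℕ (from k e) ℕ.< toℕ (to k e)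
  from<to zero zero = s≤s z≤n
  from<to (suc k) e with arcView e
  ... | fresh j rewrite from-fresh k j | to-fresh k j = odd-node-positive j
  ... | old zero rewrite from-↑ʳ k zero | to-↑ʳ k zero = s≤s (s≤s z≤n)
  ... | old (suc e′) rewrite from-↑ʳ k (suc e′) | to-↑ʳ k (suc e′) = s≤s (s≤s (from<to k e′))

  inner-arc : ∀ k e → isOdd (from k e) ≡ false → from k e ≢ zero → e ∈ inner-arcs k
  inner-arc zero zero _ nonzero = contradiction refl nonzero
  inner-arc (suc k) e even nonzero with arcView e
  ... | fresh j = contradiction (from-fresh k j) nonzero
  ... | old zero = contradiction (trans (sym even) (cong isOdd (from-↑ʳ k zero))) λ ()
  ... | old (suc e′) = lookup⇒[]= _ (inner-arcs (suc k)) (begin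
    lookup (inner-arcs (suc k)) ((2 ℕ.+ k) ↑ʳ suc e′)
      ≡⟨ lookup-++ʳ (Vec.replicate (2 ℕ.+ k) outside) (outside ∷ ∁ (bridges k)) (suc e′) ⟩
    lookup (∁ (bridges k)) e′                          ≡⟨ lookup-map e′ not (bridges k) ⟩
    not (lookup (bridges k) e′)
      ≡⟨ cong not (trans (lookup-bridges k e′) (trans (sym (cong isOdd (from-↑ʳ k (suc e′)))) even)) ⟩
    true ∎)

  zero≢from-old : ∀ k f → zero ≢ from-old k f
  zero≢from-old k zero ()
  zero≢from-old k (suc f) ()

  extremal-simple : ∀ k → Simple (extremal k)
  extremal-simple zero zero zero _ _ = refl
  extremal-simple (suc k) e e′ tails heads with arcView e | arcView e′
  ... | fresh i | fresh j =
    cong (_↑ˡ suc (arcs k)) (odd-node-injective i j (trans (sym (to-fresh k i)) (trans heads (to-fresh k j))))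
  ... | fresh i | old f = contradiction (trans (sym (from-fresh k i)) (trans tails (from-↑ʳ k f))) (zero≢from-old k f)
  ... | old f | fresh j = contradiction (trans (sym (from-fresh k j)) (trans (sym tails) (from-↑ʳ k f))) (zero≢from-old k f)
  ... | old f | old g = cong ((2 ℕ.+ k) ↑ʳ_)
    (old-simple f g (trans (sym (from-↑ʳ k f)) (trans tails (from-↑ʳ k g)))
      (trans (sym (to-↑ʳ k f)) (trans heads (to-↑ʳ k g))))
    where
    old-simple : ∀ f g → from-old k f ≡ from-old k g → to-old k f ≡ to-old k g → f ≡ g
    old-simple zero zero _ _ = refl
    old-simple (suc f) (suc g) p q =
      cong suc (extremal-simple k f g (suc-injective (suc-injective p)) (suc-injective (suc-injective q)))

  ≤last-node : ∀ k (v : Fin (nodes k)) → toℕ v ℕ.≤ toℕ (last-node k)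
  ≤last-node zero zero = z≤n
  ≤last-node zero (suc zero) = s≤s z≤n
  ≤last-node (suc k) zero = z≤n
  ≤last-node (suc k) (suc zero) = s≤s z≤n
  ≤last-node (suc k) (suc (suc v)) = s≤s (s≤s (≤last-node k v))

  -- Counting nodes, arcs and the two arc sets

  ∣outside++∣ : ∀ {l} a (p : Subset l) → ∣ Vec.replicate a outside Vec.++ p ∣ ≡ ∣ p ∣
  ∣outside++∣ zero p = refl
  ∣outside++∣ (suc a) p = ∣outside++∣ a p

  ∣bridges∣ : ∀ k → ∣ bridges k ∣ ≡ k
  ∣bridges∣ zero = refl
  ∣bridges∣ (suc k) = trans (∣outside++∣ (2 ℕ.+ k) (inside ∷ bridges k)) (cong suc (∣bridges∣ k))

  -- There are (k+1)(k+2)/2 arcs a_i → b_j and k bridges.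
  2*arcs : ∀ k → 2 ℕ.* arcs k ≡ suc (suc k) ℕ.* suc k ℕ.+ 2 ℕ.* k
  2*arcs zero = refl
  2*arcs (suc k) = begin
    2 ℕ.* ((2 ℕ.+ k) ℕ.+ suc (arcs k))
      ≡⟨ solveℕ 2 (λ k a → lit 2 ⊛ ((lit 2 ⊕ k) ⊕ (lit 1 ⊕ a)) ≔ lit 6 ⊕ lit 2 ⊛ k ⊕ lit 2 ⊛ a) refl k (arcs k) ⟩
    6 ℕ.+ 2 ℕ.* k ℕ.+ 2 ℕ.* arcs k           ≡⟨ cong (6 ℕ.+ 2 ℕ.* k ℕ.+_) (2*arcs k) ⟩
    6 ℕ.+ 2 ℕ.* k ℕ.+ (suc (suc k) ℕ.* suc k ℕ.+ 2 ℕ.* k)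
      ≡⟨ solveℕ 1 (λ k → lit 6 ⊕ lit 2 ⊛ k ⊕ ((lit 2 ⊕ k) ⊛ (lit 1 ⊕ k) ⊕ lit 2 ⊛ k)
                       ≔ (lit 3 ⊕ k) ⊛ (lit 2 ⊕ k) ⊕ lit 2 ⊛ (lit 1 ⊕ k)) refl k ⟩
    suc (suc (suc k)) ℕ.* suc (suc k) ℕ.+ 2 ℕ.* suc k ∎

  ∣non-bridges∣ : ∀ k → ∣ ∁ (bridges k) ∣ ≡ arcs k ℕ.∸ k
  ∣non-bridges∣ k = trans (∣∁p∣≡n∸∣p∣ (bridges k)) (cong (arcs k ℕ.∸_) (∣bridges∣ k))

  2*∣inner-arcs∣ : ∀ k → 2 ℕ.* ∣ inner-arcs k ∣ ≡ suc k ℕ.* k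
  2*∣inner-arcs∣ zero = refl
  2*∣inner-arcs∣ (suc k) = begin
    2 ℕ.* ∣ inner-arcs (suc k) ∣
      ≡⟨ cong (2 ℕ.*_) (trans (∣outside++∣ (2 ℕ.+ k) (outside ∷ ∁ (bridges k))) (∣non-bridges∣ k)) ⟩
    2 ℕ.* (arcs k ℕ.∸ k)              ≡⟨ ℕ.*-distribˡ-∸ 2 (arcs k) k ⟩
    2 ℕ.* arcs k ℕ.∸ 2 ℕ.* k          ≡⟨ cong (ℕ._∸ 2 ℕ.* k) (2*arcs k) ⟩
    suc (suc k) ℕ.* suc k ℕ.+ 2 ℕ.* k ℕ.∸ 2 ℕ.* k  ≡⟨ ℕ.m+n∸n≡m (suc (suc k) ℕ.* suc k) (2 ℕ.* k) ⟩
    suc (suc k) ℕ.* suc k ∎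

  nodes≡ : ∀ k → nodes k ≡ 2 ℕ.* k ℕ.+ 2
  nodes≡ zero = refl
  nodes≡ (suc k) = trans (cong (2 ℕ.+_) (nodes≡ k))
    (solveℕ 1 (λ k → lit 2 ⊕ (lit 2 ⊛ k ⊕ lit 2) ≔ lit 2 ⊛ (lit 1 ⊕ k) ⊕ lit 2) refl k)

  -- The inner arcs number exactly m - n + 1, the value of the general lower bound.
  arcs≡∣inner-arcs∣+nodes-1 : ∀ k → arcs k ≡ ∣ inner-arcs k ∣ ℕ.+ (nodes k ℕ.∸ 1)
  arcs≡∣inner-arcs∣+nodes-1 zero = refl
  arcs≡∣inner-arcs∣+nodes-1 (suc k) = begin
    2 ℕ.+ k ℕ.+ suc (arcs k)           ≡⟨ cong (λ a → 2 ℕ.+ k ℕ.+ suc a) (ℕ.m+[n∸m]≡n k≤arcs) ⟨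
    2 ℕ.+ k ℕ.+ suc (k ℕ.+ (arcs k ℕ.∸ k))
      ≡⟨ solveℕ 2 (λ k c → lit 2 ⊕ k ⊕ (lit 1 ⊕ (k ⊕ c)) ≔ c ⊕ (lit 1 ⊕ (lit 2 ⊛ k ⊕ lit 2))) refl k (arcs k ℕ.∸ k) ⟩
    (arcs k ℕ.∸ k) ℕ.+ suc (2 ℕ.* k ℕ.+ 2)
      ≡⟨ cong₂ (λ a b → a ℕ.+ suc b) (trans (∣outside++∣ (2 ℕ.+ k) (outside ∷ ∁ (bridges k))) (∣non-bridges∣ k)) (nodes≡ k) ⟨
    ∣ inner-arcs (suc k) ∣ ℕ.+ suc (nodes k) ∎
    where
    k≤arcs : k ℕ.≤ arcs k
    k≤arcs = subst (ℕ._≤ arcs k) (∣bridges∣ k) (∣p∣≤n (bridges k))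

  -- Identifying sets of the extremal graphs

  module Extremal (k : ℕ) where

    private
      G = extremal k
      t = last-node k

    open Graph G

    walk-ascends : ∀ {u v es} → Walk G u v es → toℕ u ℕ.≤ toℕ v
    walk-ascends nil = ℕ.≤-refl
    walk-ascends (cons e refl p) = ℕ.≤-trans (ℕ.<⇒≤ (from<to k e)) (walk-ascends p)

    extremal-acyclic : Acyclic G
    extremal-acyclic (u , e , es , cons e refl p) = ℕ.<⇒≱ (from<to k e) (walk-ascends p)

    walk-ascends-to-tail : ∀ {u v es f} → Walk G u v es → f List.∈ es → toℕ u ℕ.≤ toℕ (from k f)
    walk-ascends-to-tail p f∈es = walk-ascends (proj₂ (walk-to-tail p f∈es))

    bridge∈ : ∀ e → isOdd (from k e) ≡ true → e ∈ bridges k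
    bridge∈ e odd = lookup⇒[]= e (bridges k) (trans (lookup-bridges k e) odd)

    bridge-determined : ∀ e f → isOdd (from k e) ≡ true → isOdd (from k f) ≡ true → from k e ≡ from k f → e ≡ f
    bridge-determined e f odd-e odd-f tails = extremal-simple k e f tails
      (toℕ-injective (trans (bridge-step k e odd-e) (trans (cong (suc ∘ toℕ) tails) (sym (bridge-step k f odd-f)))))

    SameBridges : List (Fin (arcs k)) → List (Fin (arcs k)) → Set
    SameBridges es es′ = ∀ e → e ∈ bridges k → e List.∈ es → e List.∈ es′

    -- The walk that enters the odd nodes earlier must leave by a bridge which the other walk has already passed.
    no-overtaking : ∀ {e e′ v es es′} → from k e ≡ from k e′ → isOdd (from k e) ≡ false → to k e ≡ v →
      Walk G v t es → Walk G (to k e′) t es′ → SameBridges (e ∷ es) (e′ ∷ es′) → ¬ (toℕ (to k e) ℕ.< toℕ (to k e′))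
    no-overtaking {e′ = e′} _ _ at-t nil _ _ lt =
      ℕ.<⇒≱ (subst (λ v → toℕ v ℕ.< toℕ (to k e′)) at-t lt) (≤last-node k (to k e′))
    no-overtaking {e} {e′} tails even refl (cons f f-from _) q same lt with same f (bridge∈ f f-odd) (there (here refl))
      where
      f-odd : isOdd (from k f) ≡ true
      f-odd = trans (cong isOdd f-from) (trans (parity-alternates k e) (cong not even))
    ... | here refl = ℕ.<⇒≢ (from<to k e) (cong toℕ (trans tails f-from))
    ... | there f∈ = ℕ.<⇒≱ lt (subst (λ v → toℕ (to k e′) ℕ.≤ toℕ v) f-from (walk-ascends-to-tail q f∈))

    from≢last-node : ∀ e → from k e ≢ t
    from≢last-node e eq = ℕ.<⇒≱ (from<to k e) (subst (λ v → toℕ (to k e) ℕ.≤ toℕ v) (sym eq) (≤last-node k (to k e)))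

    -- Compare the first arcs. A node b_i has a single leaving arc. At a node a_i, `no-overtaking`
    -- forbids either head to come before the other, so the heads agree.
    bridges-determine-walk : ∀ {u es es′} → Walk G u t es → Walk G u t es′ →
      SameBridges es es′ → SameBridges es′ es → es ≡ es′
    bridges-determine-walk nil nil _ _ = refl
    bridges-determine-walk nil (cons e eq q) _ _ = contradiction eq (from≢last-node e)
    bridges-determine-walk (cons e eq p) nil _ _ = contradiction eq (from≢last-node e)
    bridges-determine-walk {es = e ∷ es} {e′ ∷ es′} (cons e refl p) (cons e′ tails q) same same′ with first-arc
      where
      first-arc : e ≡ e′
      first-arc with isOdd (from k e) in parity
      ... | true = bridge-determined e e′ parity (trans (cong isOdd tails) parity) (sym tails)
      ... | false with ℕ.<-cmp (toℕ (to k e)) (toℕ (to k e′))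
      ...   | tri< lt _ _ = contradiction lt (no-overtaking (sym tails) parity refl p q same)
      ...   | tri≈ _ heads _ = extremal-simple k e e′ (sym tails) (toℕ-injective heads)
      ...   | tri> _ _ gt = contradiction gt (no-overtaking tails (trans (cong isOdd tails) parity) refl q p same′)
    ... | refl = cong (e ∷_) (bridges-determine-walk p q (tail-bridges p same) (tail-bridges q same′))
      where
      tail-bridges : ∀ {v es es′} → Walk G (to k e) v es → SameBridges (e ∷ es) (e ∷ es′) → SameBridges es es′
      tail-bridges p same f f∈S f∈es with same f f∈S (there f∈es)
      -- The first arc cannot recur later, since the nodes of a walk increase; removing it from both
      -- walks keeps their bridges equal.
      ... | here refl = contradiction (walk-ascends-to-tail p f∈es) (ℕ.<⇒≱ (from<to k e))
      ... | there f∈es′ = f∈es′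

    χ-∈ : ∀ {es es′ e} → χ G es e ≡ χ G es′ e → e List.∈ es → e List.∈ es′
    χ-∈ {es} {es′} {e} eq e∈es with Any.any? (e ≟_) es | Any.any? (e ≟_) es′
    ... | _ | yes e∈es′ = e∈es′
    ... | no e∉es | no _ = contradiction e∈es e∉es
    ... | yes _ | no _ = contradiction eq λ ()

    bridges-identifying : Identifying G (Xpath G zero t) (bridges k)
    bridges-identifying x x′ (es , (p , _) , x≡χ) (es′ , (p′ , _) , x′≡χ) differ
      with any? (λ e → (e ∈? bridges k) ×-dec ¬? (x e ℚₚ.≟ x′ e))
    ... | yes found = found
    ... | no none = contradiction (λ e → trans (x≡χ e) (trans (cong (λ fs → χ G fs e) same-walk) (sym (x′≡χ e)))) differ
      where
      agree : ∀ e → e ∈ bridges k → χ G es e ≡ χ G es′ e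
      agree e e∈S = trans (sym (x≡χ e)) (trans (decidable-stable (x e ℚₚ.≟ x′ e) (λ x≢x′ → none (e , e∈S , x≢x′))) (x′≡χ e))
      same-walk : es ≡ es′
      same-walk = bridges-determine-walk p p′ (λ e e∈S → χ-∈ (agree e e∈S)) (λ e e∈S → χ-∈ (sym (agree e e∈S)))

    through-zero : ∀ {l} (φ : Fin (arcs k) → Fin l) {z} v → (∀ e → φ e ≡ v → z e ≡ 0ℚ) → through φ z v ≡ 0ℚ
    through-zero φ {z} v vanish = ∑-zero term
      where
      term : ∀ e → (if does (φ e ≟ v) then z e else 0ℚ) ≡ 0ℚ
      term e with φ e ≟ v
      ... | yes eq = vanish e eq
      ... | no _ = refl

    through-single : ∀ {l} (φ : Fin (arcs k) → Fin l) {z} e → (∀ f → φ f ≡ φ e → f ≢ e → z f ≡ 0ℚ) → through φ z (φ e) ≡ z e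
    through-single φ {z} e vanish = trans (∑-cong term) (∑-δ e z)
      where
      term : ∀ f → (if does (φ f ≟ φ e) then z f else 0ℚ) ≡ δ e f * z f
      term f with f ≟ e
      ... | yes refl = trans (cong (λ b → if b then z e else 0ℚ) (dec-true (φ e ≟ φ e) refl))
                         (sym (trans (cong (_* z e) (δ-refl e)) (*-identityˡ (z e))))
      ... | no f≢e with φ f ≟ φ e
      ...   | yes eq = trans (vanish f eq f≢e) (sym (trans (cong (δ e f *_) (vanish f eq f≢e)) (*-zeroʳ (δ e f))))
      ...   | no _ = sym (trans (cong (_* z f) (δ-≢ (f≢e ∘ sym))) (*-zeroˡ (z f)))

    module _ {z : Vect G} (circ : Circulation z) (inner : ∀ e → e ∈ inner-arcs k → z e ≡ 0ℚ) where

      private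
        to≢zero : ∀ e → to k e ≢ zero
        to≢zero e eq = ℕ.n≮0 (subst (λ v → toℕ (from k e) ℕ.< toℕ v) eq (from<to k e))

      -- The bridge is the only arc that enters its head a_{i+1}, and every arc that leaves a_{i+1}
      -- is inner. Conservation at that node gives zero.
      circulation-on-bridge : ∀ e → isOdd (from k e) ≡ true → z e ≡ 0ℚ
      circulation-on-bridge e odd = begin
        z e                    ≡⟨ through-single (to k) e unique ⟨
        inflow G z (to k e)    ≡⟨ circ (to k e) ⟨
        outflow G z (to k e)   ≡⟨ through-zero (from k) (to k e) leaving ⟩
        0ℚ ∎
        where
        to-even : isOdd (to k e) ≡ false
        to-even = trans (parity-alternates k e) (cong not odd)
        leaving : ∀ f → from k f ≡ to k e → z f ≡ 0ℚ
        leaving f eq = inner f (inner-arc k f (trans (cong isOdd eq) to-even) (λ zf → to≢zero e (trans (sym eq) zf)))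
        unique : ∀ f → to k f ≡ to k e → f ≢ e → z f ≡ 0ℚ
        unique f heads f≢e = contradiction (extremal-simple k f e
          (toℕ-injective (ℕ.suc-injective (trans (sym (bridge-step k f f-odd)) (trans (cong toℕ heads) (bridge-step k e odd))))) heads) f≢e
          where
          f-odd : isOdd (from k f) ≡ true
          f-odd = Bool.not-injective (trans (sym (parity-alternates k f)) (trans (cong isOdd heads) to-even))

      -- What remains are the arcs a₀ → b_j. All other arcs into b_j are inner, and any arc out of
      -- b_j is a bridge, so conservation at b_j settles them.
      circulation-vanishes : ∀ e → z e ≡ 0ℚ
      circulation-vanishes e with isOdd (from k e) in parity | from k e ≟ zero
      ... | true | _ = circulation-on-bridge e parity
      ... | false | no nonzero = inner e (inner-arc k e parity nonzero)
      ... | false | yes from-zero = begin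
        z e                    ≡⟨ through-single (to k) e unique ⟨
        inflow G z (to k e)    ≡⟨ circ (to k e) ⟨
        outflow G z (to k e)   ≡⟨ through-zero (from k) (to k e) leaving ⟩
        0ℚ ∎
        where
        to-odd : isOdd (to k e) ≡ true
        to-odd = trans (parity-alternates k e) (cong not parity)
        leaving : ∀ f → from k f ≡ to k e → z f ≡ 0ℚ
        leaving f eq = circulation-on-bridge f (trans (cong isOdd eq) to-odd)
        unique : ∀ f → to k f ≡ to k e → f ≢ e → z f ≡ 0ℚ
        unique f heads f≢e = inner f (inner-arc k f
          (Bool.not-injective (trans (sym (parity-alternates k f)) (trans (cong isOdd heads) to-odd)))
          (λ f-zero → f≢e (extremal-simple k f e (trans f-zero (sym from-zero)) heads)))

    inner-arcs-identifying : Identifying G (Xflow G zero t) (inner-arcs k)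
    inner-arcs-identifying x x′ flow flow′ differ with any? (λ e → (e ∈? inner-arcs k) ×-dec ¬? (x e ℚₚ.≟ x′ e))
    ... | yes found = found
    ... | no none = contradiction (λ e → x-y≡0⇒x≡y (circulation-vanishes (flow-difference flow flow′) agree e)) differ
      where
      agree : ∀ e → e ∈ inner-arcs k → x e - x′ e ≡ 0ℚ
      agree e e∈S′ = x≡y⇒x-y≡0 (decidable-stable (x e ℚₚ.≟ x′ e) (λ x≢x′ → none (e , e∈S′ , x≢x′)))

  -- A strictly positive unit flow

  ∑-++ : ∀ a {b} (f : Fin (a ℕ.+ b) → ℚ) → ∑ f ≡ ∑ (λ i → f (i ↑ˡ b)) + ∑ (λ j → f (a ↑ʳ j))
  ∑-++ zero f = sym (+-identityˡ (∑ f))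
  ∑-++ (suc a) {b} f = trans (cong (f zero +_) (∑-++ a (f ∘ suc)))
    (sym (+-assoc (f zero) (∑ (λ i → f (suc (i ↑ˡ b)))) (∑ (λ j → f (suc a ↑ʳ j)))))

  through-splitAt : ∀ {a b l} (φ : Fin a → Fin l) (ψ : Fin b → Fin l) x y v →
    through ([ φ , ψ ]′ ∘ splitAt a) ([ x , y ]′ ∘ splitAt a) v ≡ through φ x v + through ψ y v
  through-splitAt {a} {b} φ ψ x y v = trans (∑-++ a _) (cong₂ _+_
    (∑-cong λ i → cong (λ s → if does ([ φ , ψ ]′ s ≟ v) then [ x , y ]′ s else 0ℚ) (splitAt-↑ˡ a i b))
    (∑-cong λ j → cong (λ s → if does ([ φ , ψ ]′ s ≟ v) then [ x , y ]′ s else 0ℚ) (splitAt-↑ʳ a b j)))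

  -- Halving: the first share is half of the amount, and the other half is split recursively.
  positive-split : ∀ l {c} → 0ℚ < c → ∃ λ (a : Fin (suc l) → ℚ) → (∀ i → 0ℚ < a i) × ∑ a ≡ c
  positive-split zero {c} c>0 = (λ _ → c) , (λ _ → c>0) , +-identityʳ c
  positive-split (suc l) {c} c>0 with positive-split l (*-pos (ℚₚ.positive⁻¹ ½) c>0)
  ... | a , a>0 , ∑a = (λ { zero → ½ * c ; (suc i) → a i }) , (λ { zero → *-pos (ℚₚ.positive⁻¹ ½) c>0 ; (suc i) → a>0 i }) ,
    trans (cong (½ * c +_) ∑a) (solve 1 (λ c → con ½ :* c :+ con ½ :* c := c) refl c)

  -- Flow with arbitrary extra supplies β, all drained at the last node, so that the recursion can pass on
  -- what the first two nodes send to the rest of the graph.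
  positive-flow : ∀ k (β : Fin (nodes k) → ℚ) → (∀ v → 0ℚ ≤ β v) → 0ℚ < β zero →
    ∃ λ x → (∀ e → 0ℚ < x e) × (∀ v → v ≢ last-node k → outflow (extremal k) x v ≡ inflow (extremal k) x v + β v)
  positive-flow zero β β≥0 β>0 = (λ _ → β zero) , (λ _ → β>0) , λ
    { zero _ → solve 1 (λ b → b :+ con 0ℚ := con 0ℚ :+ b) refl (β zero)
    ; (suc zero) ≢last → contradiction refl ≢last }
  positive-flow (suc k) β β≥0 β>0 = x , x>0 , conserved
    where
    split = positive-split (suc k) β>0
    a = proj₁ split
    a>0 = proj₁ (proj₂ split)
    ∑a = proj₂ (proj₂ split)
    -- Everything that arrives at b₀, the share from a₀ and its own supply, has to leave by the
    -- bridge.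
    bridge = a zero + β (suc zero)
    bridge>0 : 0ℚ < bridge
    bridge>0 = ℚₚ.+-mono-<-≤ (a>0 zero) (β≥0 (suc zero))
    -- What enters the smaller graph: the shares on a₀ → b_j with j ≥ 1, and the value of the bridge
    -- at a₁.
    passed : Fin (nodes k) → ℚ
    passed v = through odd-node a (suc (suc v)) + (if does (zero ≟ v) then bridge else 0ℚ)
    passed≥0 : ∀ v → 0ℚ ≤ through odd-node a (suc (suc v))
    passed≥0 v = ∑-nonNeg λ j → if-nonNeg (does (odd-node {suc k} j ≟ suc (suc v))) (ℚₚ.<⇒≤ (a>0 j))
    β′ : Fin (nodes k) → ℚ
    β′ v = β (suc (suc v)) + passed v
    rec = positive-flow k β′
      (λ v → ℚₚ.+-mono-≤ (β≥0 (suc (suc v))) (ℚₚ.+-mono-≤ (passed≥0 v) (if-nonNeg (does (zero ≟ v)) (ℚₚ.<⇒≤ bridge>0))))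
      -- The bridge makes the supply at the next first node positive.
      (ℚₚ.+-mono-≤-< (β≥0 (suc (suc zero))) (ℚₚ.+-mono-≤-< (passed≥0 zero) bridge>0))
    x′ = proj₁ rec
    y : Fin (suc (arcs k)) → ℚ
    y zero = bridge
    y (suc e) = x′ e
    y>0 : ∀ e → 0ℚ < y e
    y>0 zero = bridge>0
    y>0 (suc e) = proj₁ (proj₂ rec) e
    x : Fin (arcs (suc k)) → ℚ
    x = [ a , y ]′ ∘ splitAt (2 ℕ.+ k)
    x>0 : ∀ e → 0ℚ < x e
    x>0 e with splitAt (2 ℕ.+ k) e
    ... | inj₁ j = a>0 j
    ... | inj₂ f = y>0 f
    out = through-splitAt (λ _ → zero) (from-old k) a y
    inn = through-splitAt odd-node (to-old k) a y
    ∑0 : ∀ l → ∑ {l} (λ _ → 0ℚ) ≡ 0ℚ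
    ∑0 l = ∑-zero {l} λ _ → refl
    into-zero : through (odd-node {suc k}) a zero ≡ 0ℚ
    into-zero = trans (+-identityˡ _) (∑0 (suc k))
    conserved : ∀ v → v ≢ last-node (suc k) → outflow (extremal (suc k)) x v ≡ inflow (extremal (suc k)) x v + β v
    conserved zero _ = begin
      outflow (extremal (suc k)) x zero             ≡⟨ out zero ⟩
      ∑ a + (0ℚ + ∑ {arcs k} (λ _ → 0ℚ))            ≡⟨ cong₂ (λ p q → p + (0ℚ + q)) ∑a (∑0 (arcs k)) ⟩
      β zero + (0ℚ + 0ℚ)
        ≡⟨ solve 1 (λ b → b :+ (con 0ℚ :+ con 0ℚ) := (con 0ℚ :+ (con 0ℚ :+ con 0ℚ)) :+ b) refl (β zero) ⟩
      (0ℚ + (0ℚ + 0ℚ)) + β zero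
        ≡⟨ cong₂ (λ p q → (p + (0ℚ + q)) + β zero) into-zero (∑0 (arcs k)) ⟨
      (through (odd-node {suc k}) a zero + (0ℚ + ∑ {arcs k} (λ _ → 0ℚ))) + β zero  ≡⟨ cong (_+ β zero) (inn zero) ⟨
      inflow (extremal (suc k)) x zero + β zero ∎
    conserved (suc zero) _ = begin
      outflow (extremal (suc k)) x (suc zero)       ≡⟨ out (suc zero) ⟩
      ∑ {2 ℕ.+ k} (λ _ → 0ℚ) + (bridge + ∑ {arcs k} (λ _ → 0ℚ))
        ≡⟨ cong₂ (λ p q → p + (bridge + q)) (∑0 (2 ℕ.+ k)) (∑0 (arcs k)) ⟩
      0ℚ + (bridge + 0ℚ)
        ≡⟨ solve 2 (λ a b → con 0ℚ :+ ((a :+ b) :+ con 0ℚ) := ((a :+ con 0ℚ) :+ (con 0ℚ :+ con 0ℚ)) :+ b) refl (a zero) (β (suc zero)) ⟩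
      ((a zero + 0ℚ) + (0ℚ + 0ℚ)) + β (suc zero)
        ≡⟨ cong₂ (λ p q → ((a zero + p) + (0ℚ + q)) + β (suc zero)) (∑0 (suc k)) (∑0 (arcs k)) ⟨
      ((a zero + ∑ {suc k} (λ _ → 0ℚ)) + (0ℚ + ∑ {arcs k} (λ _ → 0ℚ))) + β (suc zero)
        ≡⟨ cong (_+ β (suc zero)) (inn (suc zero)) ⟨
      inflow (extremal (suc k)) x (suc zero) + β (suc zero) ∎
    conserved (suc (suc v)) ≢last = begin
      outflow (extremal (suc k)) x (suc (suc v))    ≡⟨ out (suc (suc v)) ⟩
      ∑ {2 ℕ.+ k} (λ _ → 0ℚ) + (0ℚ + outflow (extremal k) x′ v)
        ≡⟨ cong₂ (λ p q → p + (0ℚ + q)) (∑0 (2 ℕ.+ k)) (proj₂ (proj₂ rec) v (λ v≡last → ≢last (cong (λ w → suc (suc w)) v≡last))) ⟩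
      0ℚ + (0ℚ + (inflow (extremal k) x′ v + (β (suc (suc v)) + (o + b))))
        ≡⟨ solve 4 (λ i β o b → con 0ℚ :+ (con 0ℚ :+ (i :+ (β :+ (o :+ b)))) := (o :+ (b :+ i)) :+ β) refl (inflow (extremal k) x′ v) (β (suc (suc v))) o b ⟩
      (o + (b + inflow (extremal k) x′ v)) + β (suc (suc v))   ≡⟨ cong (_+ β (suc (suc v))) (inn (suc (suc v))) ⟨
      inflow (extremal (suc k)) x (suc (suc v)) + β (suc (suc v)) ∎
      where
      o = through odd-node a (suc (suc v))
      b = if does (zero ≟ v) then bridge else 0ℚ

  zero≢last-node : ∀ k → zero ≢ last-node k
  zero≢last-node zero ()
  zero≢last-node (suc k) ()

  -- One unit is supplied at s. `positive-flow` says nothing about the last node; its balance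
  -- follows from the equality of total outflow and total inflow.
  extremal-flow : ∀ k → ∃ λ x → Xflow (extremal k) zero (last-node k) x × (∀ e → 0ℚ < x e)
  extremal-flow k with positive-flow k (δ zero) (λ v → if-nonNeg (does (zero ≟ v)) (ℚₚ.nonNegative⁻¹ 1ℚ)) (ℚₚ.positive⁻¹ 1ℚ)
  ... | x , x>0 , supplied = x , ((λ e → ℚₚ.<⇒≤ (x>0 e)) , conserved , supplied zero (zero≢last-node k) , drained) , x>0
    where
    G = extremal k
    s : Fin (nodes k)
    s = zero
    t = last-node k
    conserved : ∀ v → v ≢ zero → v ≢ t → outflow G x v ≡ inflow G x v
    conserved v v≢0 v≢t = trans (supplied v v≢t)
      (trans (cong (inflow G x v +_) (δ-≢ (v≢0 ∘ sym))) (+-identityʳ (inflow G x v)))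
    ∑δ : ∀ {l} (i : Fin l) → ∑ (δ i) ≡ 1ℚ
    ∑δ i = trans (∑-cong (λ j → sym (ℚₚ.*-identityʳ (δ i j)))) (∑-δ i (λ _ → 1ℚ))
    drained : inflow G x t ≡ outflow G x t + 1ℚ
    drained = sym (begin
      outflow G x t + 1ℚ        ≡⟨ cong (outflow G x t +_) (δ-refl t) ⟨
      outflow G x t + δ t t
        ≡⟨ equal-sums (λ v → outflow G x v + δ t v) (λ v → inflow G x v + δ zero v) t sums balanced ⟩
      inflow G x t + δ zero t   ≡⟨ cong (inflow G x t +_) (δ-≢ (zero≢last-node k)) ⟩
      inflow G x t + 0ℚ         ≡⟨ +-identityʳ (inflow G x t) ⟩
      inflow G x t ∎)
      where
      sums : ∑ (λ v → outflow G x v + δ t v) ≡ ∑ (λ v → inflow G x v + δ zero v)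
      sums = begin
        ∑ (λ v → outflow G x v + δ t v)    ≡⟨ ∑-+ (outflow G x) (δ t) ⟩
        ∑ (outflow G x) + ∑ (δ t)          ≡⟨ cong₂ _+_ (through-total (from k) x) (∑δ t) ⟩
        ∑ x + 1ℚ                           ≡⟨ cong₂ _+_ (through-total (to k) x) (∑δ s) ⟨
        ∑ (inflow G x) + ∑ (δ s)           ≡⟨ ∑-+ (inflow G x) (δ s) ⟨
        ∑ (λ v → inflow G x v + δ zero v) ∎
      balanced : ∀ v → v ≢ t → outflow G x v + δ t v ≡ inflow G x v + δ zero v
      balanced v v≢t = trans (cong (outflow G x v +_) (δ-≢ (v≢t ∘ sym))) (trans (+-identityʳ (outflow G x v)) (supplied v v≢t))

  -- Optimality of both arc sets

  inner-arcs-minimum : ∀ k → MinIdentifying (extremal k) (Xflow (extremal k) zero (last-node k)) (inner-arcs k)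
  inner-arcs-minimum k = Extremal.inner-arcs-identifying k , λ T T-identifying →
    ℕ.+-cancelʳ-≤ (nodes k ℕ.∸ 1) ∣ inner-arcs k ∣ ∣ T ∣
      (subst (ℕ._≤ ∣ T ∣ ℕ.+ (nodes k ℕ.∸ 1)) (arcs≡∣inner-arcs∣+nodes-1 k)
        (let _ , flow , x>0 = extremal-flow k in LowerBound.arcs≤identifying+nodes (extremal k) flow x>0 T T-identifying))

  -- If fewer than k arcs identified the paths, the upper bound would make a minimum identifying set
  -- for flows smaller than `inner-arcs k`, which is already a minimum one.
  bridges-minimum : ∀ k → MinIdentifying (extremal k) (Xpath (extremal k) zero (last-node k)) (bridges k)
  bridges-minimum k = Extremal.bridges-identifying k , λ T T-identifying →
    subst (ℕ._≤ ∣ T ∣) (sym (∣bridges∣ k)) (ℕ.≮⇒≥ λ T<k →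
      ℕ.<⇒≱ (ℕ.*-mono-< (s≤s T<k) T<k)
        (subst (ℕ._≤ suc ∣ T ∣ ℕ.* ∣ T ∣) (2*∣inner-arcs∣ k)
          (UpperBound.flow-minimum-bound (extremal k) (Extremal.extremal-acyclic k) zero (last-node k) T T-identifying
            (inner-arcs k) (proj₂ (inner-arcs-minimum k)))))

open IdentifyingSets
open import Defs
open import Data.Nat using (ℕ; suc; _*_; _≤_)
open import Data.Fin using (Fin; zero)
open import Data.Fin.Subset using (Subset; ∣_∣)
open import Data.Product using (Σ; _×_; _,_)
open import Relation.Binary.PropositionalEquality using (_≡_; subst; sym)

theorem4p5 : ((G : Digraph) → Simple G → Acyclic G → (s t : Fin (n G)) → (S S' : Subset (m G)) →
    MinIdentifying G (Xpath G s t) S → MinIdentifying G (Xflow G s t) S' →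
    2 * ∣ S' ∣ ≤ suc ∣ S ∣ * ∣ S ∣)
    ×
    ((k : ℕ) → Σ Digraph λ G → Simple G × Acyclic G × Σ (Fin (n G)) λ s → Σ (Fin (n G)) λ t →
    Σ (Subset (m G)) λ S → Σ (Subset (m G)) λ S' →
    MinIdentifying G (Xpath G s t) S × MinIdentifying G (Xflow G s t) S' ×
    ∣ S ∣ ≡ k × 2 * ∣ S' ∣ ≡ suc ∣ S ∣ * ∣ S ∣)
theorem4p5 =
  (λ G _ acyclic s t S S' (S-identifying , _) (_ , S'-minimum) →
    UpperBound.flow-minimum-bound G acyclic s t S S-identifying S' S'-minimum) ,
  λ k → extremal k , extremal-simple k , Extremal.extremal-acyclic k , zero , last-node k ,
    bridges k , inner-arcs k , bridges-minimum k , inner-arcs-minimum k , ∣bridges∣ k ,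
    subst (λ l → 2 * ∣ inner-arcs k ∣ ≡ suc l * l) (sym (∣bridges∣ k)) (2*∣inner-arcs∣ k)
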